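{- Let $p$ be a prime, let $\alpha$ be a positive integer, $l,n\in\{0,1,2,\ldots\}$ and $r\in\mathbb{Z}$. Then $$\frac{1}{\lfloor n/p^{\alpha-1}\rfloor!}\sum_{k\equiv r\ (\mathrm{mod}\ p^\alpha)}(-1)^k\binom{pn}{pk}\left(\frac{k-r}{p^{\alpha-1}}\right)^l\equiv\frac{1}{\lfloor n/p^{\alpha-1}\rfloor!}\sum_{k\equiv r\ (\mathrm{mod}\ p^\alpha)}(-1)^k\binom{n}{k}\left(\frac{k-r}{p^{\alpha-1}}\right)^l\pmod{p^{a_p}},$$ where $a_p=1$ if $p=2$, $a_p=2$ if $p=3$, and $a_p=3$ if $p>3$.
   Context: The sums run over all integers $k\equiv r\pmod{p^\alpha}$, with binomial coefficients $\binom{N}{K}=0$ unless $0\le K\le N$; the convention $0^0=1$ is used. Both sides are rational numbers, and the congruence modulo $p^{a_p}$ means that their difference is a rational number lying in $p^{a_p}\mathbb{Z}_p$ (the ring of $p$-adic integers). -}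

module Defs where

open import Data.Nat as ℕ using (ℕ; zero; suc; _!; _/_)
open import Data.Nat.Properties using (_!≢0)
open import Data.Nat.Combinatorics using (_C_)
open import Data.Nat.Divisibility as ℕD using ()
open import Data.Integer as ℤ using (ℤ; +_)
open import Data.Integer.Divisibility as ℤD using ()
open import Data.Rational as ℚ using (ℚ; 0ℚ; 1ℚ)
open import Data.List using (List; upTo; foldr; map)
open import Data.Product using (∃; ∃-syntax; _×_)
open import Relation.Nullary using (¬_; yes; no)
open import Relation.Binary.PropositionalEquality using (_≡_)

_^ℚ_ : ℚ → ℕ → ℚ
x ^ℚ zero  = 1ℚ
x ^ℚ suc n = x ℚ.* (x ^ℚ n)

ℤ→ℚ : ℤ → ℚ
ℤ→ℚ z = z ℚ./ 1

ℕ→ℚ : ℕ → ℚ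
ℕ→ℚ n = ℤ→ℚ (+ n)

sign : ℕ → ℚ
sign k = (ℚ.- 1ℚ) ^ℚ k

sumTo : ℕ → (ℕ → ℚ) → ℚ
sumTo n f = foldr ℚ._+_ 0ℚ (map f (upTo (suc n)))

sumCong : (n m : ℕ) (r : ℤ) → (ℕ → ℚ) → ℚ
sumCong n m r f = sumTo n (λ k → sel k)
  where
  sel : ℕ → ℚ
  sel k with m ℕD.∣? ℤ.∣ (+ k) ℤ.- r ∣
  ... | yes _ = f k
  ... | no  _ = 0ℚ

open import Data.Nat.Primality using (Prime; prime)
open import Data.Nat.Properties using (m^n≢0)

primeNZ : ∀ {p} → Prime p → ℕ.NonZero p
primeNZ {p} (prime _) = ℕ.nonTrivial⇒nonZero p

pow : ∀ {p} → Prime p → ℕ → ℕ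
pow {p} _ α = p ℕ.^ (α ℕ.∸ 1)

powNZ : ∀ {p} (pp : Prime p) α → ℕ.NonZero (pow pp α)
powNZ {p} pp α = m^n≢0 p (α ℕ.∸ 1) {{primeNZ pp}}

quot : ∀ {p} → Prime p → (α k : ℕ) (r : ℤ) → ℚ
quot pp α k r = ℚ._/_ ((+ k) ℤ.- r) (pow pp α) {{powNZ pp α}}

flr : ∀ {p} → Prime p → (n α : ℕ) → ℕ
flr pp n α = _/_ n (pow pp α) {{powNZ pp α}}

invFact : ℕ → ℚ
invFact m = ℚ._/_ (+ 1) (m !) {{m !≢0}}

aₚ : ℕ → ℕ
aₚ 2 = 1
aₚ 3 = 2
aₚ _ = 3

-- x ≡ y (mod p^a) in ℤ_p, for rationals x y:  x - y ∈ p^a ℤ_p ∩ ℚ,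
-- i.e. x - y = p^a u / v with u ∈ ℤ, v ∈ ℕ, p ∤ v.
CongPadic : (p a : ℕ) → ℚ → ℚ → Set
CongPadic p a x y =
  ∃[ u ] ∃[ v ] (¬ (p ℕD.∣ v)) × ((x ℚ.- y) ℚ.* ℕ→ℚ v ≡ ℤ→ℚ ((+ (p ℕ.^ a)) ℤ.* u))

LHS : ∀ {p} → Prime p → (α l n : ℕ) (r : ℤ) → ℚ
LHS {p} pp α l n r = invFact (flr pp n α) ℚ.*
  sumCong n (p ℕ.^ α) r (λ k → sign k ℚ.* ℕ→ℚ ((p ℕ.* n) C (p ℕ.* k)) ℚ.* (quot pp α k r ^ℚ l))

RHS : ∀ {p} → Prime p → (α l n : ℕ) (r : ℤ) → ℚ
RHS {p} pp α l n r = invFact (flr pp n α) ℚ.*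
  sumCong n (p ℕ.^ α) r (λ k → sign k ℚ.* ℕ→ℚ (n C k) ℚ.* (quot pp α k r ^ℚ l))

module Submission where

-- Let the shift X act on functions ℕ → ℤ by (X f) k = f (k + 1), and let f k be ((k - r) / p^(α-1))^l
-- if p^α ∣ k - r and 0 otherwise. The right-hand sum is ((1 - X)^n f) 0. For the left-hand one,
-- transport f to the multiples of p: if (U f) (p k) = (-1)^k (f k) and U f vanishes elsewhere, then
-- the sum is ((1 + X)^(p n) (U f)) 0, and X^p U = - U X. Write (1 + X)^p = 1 + X^p + p g and expand:
--   (1 + X)^(p n) (U f) = Σ_j C(n,j) p^j g^j U ((1 - X)^(n-j) f).
-- The term j = 0 is the right-hand sum and the term j = 1 vanishes at 0, since g only involves X^i
-- with 0 < i < p. Since ⌊m / p^(α-1)⌋! divides (1 - X)^m f p-adically, the term j is divisible by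
-- (p^j / j!) ⌊n / p^(α-1)⌋!, which suffices except for j = 2, p > 3; there Wolstenholme's
-- congruence supplies the missing factor p.
--
-- The divisibility of (1 - X)^m f: put w = (1 - X)^q with q = p^(α-1). Then
-- w^p = (1 - X^(p q)) + p w u + p² v, and the a-th power of 1 - X^(p q) gains a factor p^a a! on
-- functions like f, as an a-th difference of polynomials. Expanding w^(p m) multinomially gives a
-- factor p^m m!, which is (p m)! up to a p-adic unit, by induction on the exponent of w.

open import Defs
open import Algebra.Bundles using (CommutativeRing)
import Algebra.Properties.CommutativeSemiring.Binomial as Binomial
import Algebra.Properties.Semiring.Exp as Exp
import Algebra.Properties.Semiring.Mult as Mult
import Algebra.Properties.Semiring.Sum as Sum
import Algebra.Solver.Ring as RingSolver
open import Algebra.Solver.Ring.AlmostCommutativeRing using (fromCommutativeRing; _-Raw-AlmostCommutative⟶_)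
open import Data.Fin as Fin using (Fin; toℕ)
open import Data.Fin.Properties using (toℕ<n)
open import Data.Integer as ℤ using (ℤ; +_; -[1+_]; 0ℤ; 1ℤ; -1ℤ)
import Data.Integer.Divisibility.Signed as ℤ∣
open ℤ∣ using (divides)
import Data.Integer.Properties as ℤ
open import Data.Integer.Tactic.RingSolver using (solve-∀)
open import Data.List using (map; foldr; applyUpTo)
open import Data.Maybe using (Maybe; just; nothing)
open import Data.Nat as ℕ using (ℕ; zero; suc; _!; _≤_; _<_; _≥_; z≤n; s≤s; NonZero)
open import Data.Nat.Combinatorics
  using (_C_; nCk+nC[k+1]≡[n+1]C[k+1]; nCk≡n!/k![n-k]!; nCk≡nC[n∸k]; nCn≡1; k![n∸k]!∣n!)
import Data.Nat.DivMod as ℕ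
import Data.Nat.Divisibility as ℕ
open import Data.Nat.Induction using (<-rec)
open import Data.Nat.Primality using (Prime; ¬prime[0]; euclidsLemma; prime⇒nonZero; prime⇒nonTrivial)
import Data.Nat.Properties as ℕ
import Data.Nat.Tactic.RingSolver as ℕSolver
open import Data.Product using (_×_; _,_; ∃-syntax; proj₁; proj₂)
open import Data.Rational as ℚ using (ℚ; 0ℚ; 1ℚ)
import Data.Rational.Properties as ℚ
import Data.Rational.Solver as ℚSolver
open import Data.Rational.Unnormalised as ℚᵘ using (mkℚᵘ; *≡*)
import Data.Rational.Unnormalised.Properties as ℚᵘ
open import Data.Sum using (_⊎_; inj₁; inj₂)
open import Function using (_∘_)
open import Relation.Binary.PropositionalEquality
  using (_≡_; _≢_; refl; sym; trans; cong; cong₂; subst; subst₂; _≗_; module ≡-Reasoning)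
import Relation.Binary.Reasoning.Setoid as SetoidReasoning
open import Relation.Nullary using (¬_; Dec; yes; no; contradiction)

-- Polynomials in the shift operator

-- Operators are syntax rather than arbitrary functions on sequences, so linearity, translation
-- invariance and commutation follow by structural induction.
data Poly : Set where
  const   : ℤ → Poly
  X       : Poly
  _⊕_ _⊗_ : Poly → Poly → Poly

⟦_⟧ : Poly → (ℕ → ℤ) → ℕ → ℤ
⟦ const c ⟧ f k = c ℤ.* f k
⟦ X ⟧       f k = f (suc k)
⟦ P ⊕ Q ⟧   f k = ⟦ P ⟧ f k ℤ.+ ⟦ Q ⟧ f k
⟦ P ⊗ Q ⟧   f   = ⟦ P ⟧ (⟦ Q ⟧ f)

⟦⟧-cong : ∀ P {f g} → f ≗ g → ⟦ P ⟧ f ≗ ⟦ P ⟧ g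
⟦⟧-cong (const c) eq k = cong (c ℤ.*_) (eq k)
⟦⟧-cong X         eq k = eq (suc k)
⟦⟧-cong (P ⊕ Q)   eq k = cong₂ ℤ._+_ (⟦⟧-cong P eq k) (⟦⟧-cong Q eq k)
⟦⟧-cong (P ⊗ Q)   eq   = ⟦⟧-cong P (⟦⟧-cong Q eq)

⟦⟧-+ : ∀ P f g k → ⟦ P ⟧ (λ i → f i ℤ.+ g i) k ≡ ⟦ P ⟧ f k ℤ.+ ⟦ P ⟧ g k
⟦⟧-+ (const c) f g k = ℤ.*-distribˡ-+ c (f k) (g k)
⟦⟧-+ X         f g k = refl
⟦⟧-+ (P ⊕ Q)   f g k = trans (cong₂ ℤ._+_ (⟦⟧-+ P f g k) (⟦⟧-+ Q f g k)) (swap (⟦ P ⟧ f k) _ _ _)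
  where
  swap : ∀ a b c d → (a ℤ.+ b) ℤ.+ (c ℤ.+ d) ≡ (a ℤ.+ c) ℤ.+ (b ℤ.+ d)
  swap = solve-∀
⟦⟧-+ (P ⊗ Q)   f g k = trans (⟦⟧-cong P (⟦⟧-+ Q f g) k) (⟦⟧-+ P _ _ k)

⟦⟧-* : ∀ P c f k → ⟦ P ⟧ (λ i → c ℤ.* f i) k ≡ c ℤ.* ⟦ P ⟧ f k
⟦⟧-* (const b) c f k = swap b c (f k)
  where
  swap : ∀ b c x → b ℤ.* (c ℤ.* x) ≡ c ℤ.* (b ℤ.* x)
  swap = solve-∀
⟦⟧-* X         c f k = refl
⟦⟧-* (P ⊕ Q)   c f k =
  trans (cong₂ ℤ._+_ (⟦⟧-* P c f k) (⟦⟧-* Q c f k)) (sym (ℤ.*-distribˡ-+ c _ _))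
⟦⟧-* (P ⊗ Q)   c f k = trans (⟦⟧-cong P (⟦⟧-* Q c f) k) (⟦⟧-* P c _ k)

⟦⟧-suc : ∀ P f k → ⟦ P ⟧ (f ∘ suc) k ≡ ⟦ P ⟧ f (suc k)
⟦⟧-suc (const c) f k = refl
⟦⟧-suc X         f k = refl
⟦⟧-suc (P ⊕ Q)   f k = cong₂ ℤ._+_ (⟦⟧-suc P f k) (⟦⟧-suc Q f k)
⟦⟧-suc (P ⊗ Q)   f k = trans (⟦⟧-cong P (⟦⟧-suc Q f) k) (⟦⟧-suc P _ k)

-- `P` commutes with constants by linearity and with `X` by translation invariance; sums and
-- composites of these give every `Q`.
⟦⟧-comm : ∀ P Q f k → ⟦ P ⟧ (⟦ Q ⟧ f) k ≡ ⟦ Q ⟧ (⟦ P ⟧ f) k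
⟦⟧-comm P (const c)  f k = ⟦⟧-* P c f k
⟦⟧-comm P X          f k = ⟦⟧-suc P f k
⟦⟧-comm P (Q₁ ⊕ Q₂)  f k =
  trans (⟦⟧-+ P _ _ k) (cong₂ ℤ._+_ (⟦⟧-comm P Q₁ f k) (⟦⟧-comm P Q₂ f k))
⟦⟧-comm P (Q₁ ⊗ Q₂)  f k =
  trans (⟦⟧-comm P Q₁ _ k) (⟦⟧-cong Q₁ (⟦⟧-comm P Q₂ f) k)

-- A record and not a bare function type, so that `P` and `Q` can be inferred from a proof of their
-- equality.
infix 4 _≈ₚ_
record _≈ₚ_ (P Q : Poly) : Set where
  constructor pointwise
  field at : ∀ f k → ⟦ P ⟧ f k ≡ ⟦ Q ⟧ f k
open _≈ₚ_

-- Up to `_≈ₚ_` this is ℤ[X], which acts faithfully on sequences. As a commutative ring it has the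
-- binomial theorem and a ring solver.
polyRing : CommutativeRing _ _
polyRing = record
  { Carrier = Poly ; _≈_ = _≈ₚ_ ; _+_ = _⊕_ ; _*_ = _⊗_
  ; -_ = const -1ℤ ⊗_ ; 0# = const 0ℤ ; 1# = const 1ℤ
  ; isCommutativeRing = record
    { isRing = record
      { +-isAbelianGroup = record
        { isGroup = record
          { isMonoid = record
            { isSemigroup = record
              { isMagma = record
                { isEquivalence = record
                  { refl  = pointwise λ f k → refl
                  ; sym   = λ p → pointwise λ f k → sym (at p f k)
                  ; trans = λ p q → pointwise λ f k → trans (at p f k) (at q f k) }
                ; ∙-cong = λ p q → pointwise λ f k → cong₂ ℤ._+_ (at p f k) (at q f k) }
              ; assoc = λ P Q R → pointwise λ f k → ℤ.+-assoc (⟦ P ⟧ f k) _ _ }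
            ; identity = (λ P → pointwise λ f k → ℤ.+-identityˡ (⟦ P ⟧ f k))
                       , (λ P → pointwise λ f k → ℤ.+-identityʳ (⟦ P ⟧ f k)) }
          ; inverse = (λ P → pointwise λ f k → invˡ (⟦ P ⟧ f k))
                    , (λ P → pointwise λ f k → invʳ (⟦ P ⟧ f k))
          ; ⁻¹-cong = λ p → pointwise λ f k → cong (-1ℤ ℤ.*_) (at p f k) }
        ; comm = λ P Q → pointwise λ f k → ℤ.+-comm (⟦ P ⟧ f k) _ }
      ; *-cong = λ {P} {P′} {Q} {Q′} p q → pointwise λ f k → trans (⟦⟧-cong P (at q f) k) (at p _ k)
      ; *-assoc = λ P Q R → pointwise λ f k → refl
      ; *-identity = (λ P → pointwise λ f k → ℤ.*-identityˡ (⟦ P ⟧ f k))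
                   , (λ P → pointwise λ f k → ⟦⟧-cong P (λ i → ℤ.*-identityˡ (f i)) k)
      ; distrib = (λ P Q R → pointwise λ f k → ⟦⟧-+ P _ _ k)
                , (λ P Q R → pointwise λ f k → refl) }
    ; *-comm = λ P Q → pointwise λ f k → ⟦⟧-comm P Q f k } }
  where
  invˡ : ∀ x → -1ℤ ℤ.* x ℤ.+ x ≡ 0ℤ
  invˡ = solve-∀
  invʳ : ∀ x → x ℤ.+ -1ℤ ℤ.* x ≡ 0ℤ
  invʳ = solve-∀

open CommutativeRing polyRing
  using (_+_; _*_; _-_; 0#; 1#; semiring; commutativeSemiring; setoid; +-cong; +-congˡ; +-congʳ;
         *-cong; *-congˡ; *-congʳ; *-assoc; *-identityˡ)
  renaming (-_ to infix 8 -_; refl to ≈-refl; sym to ≈-sym; trans to ≈-trans; reflexive to ≈-reflexive)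
open Exp semiring using (_^_; ^-congˡ; ^-homo-*; ^-assocʳ)
open Mult semiring using () renaming (_×_ to _·_)
open Sum semiring using (sum; sum-cong-≋; ∑-distrib-+; *-distribˡ-sum)
module ≈-Reasoning = SetoidReasoning setoid

const-morphism : ℤ.+-*-rawRing -Raw-AlmostCommutative⟶ fromCommutativeRing polyRing
const-morphism = record
  { ⟦_⟧    = const
  ; +-homo = λ a b → pointwise λ f k → ℤ.*-distribʳ-+ (f k) a b
  ; *-homo = λ a b → pointwise λ f k → ℤ.*-assoc a b (f k)
  ; -‿homo = λ a → pointwise λ f k → neg a (f k)
  ; 0-homo = ≈-refl
  ; 1-homo = ≈-refl }
  where
  neg : ∀ a x → ℤ.- a ℤ.* x ≡ -1ℤ ℤ.* (a ℤ.* x)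
  neg = solve-∀

const-≟ : ∀ a b → Maybe (const a ≈ₚ const b)
const-≟ a b with a ℤ.≟ b
... | yes refl = just ≈-refl
... | no  _    = nothing

module PolySolver =
  RingSolver ℤ.+-*-rawRing (fromCommutativeRing polyRing) const-morphism const-≟
open PolySolver using (solve; _:=_; _:+_; _:*_; _:-_; :-_; con)

·-act : ∀ n P f k → ⟦ n · P ⟧ f k ≡ + n ℤ.* ⟦ P ⟧ f k
·-act zero    P f k = refl
·-act (suc n) P f k = trans (cong (ℤ._+_ (⟦ P ⟧ f k)) (·-act n P f k)) (sym (ℤ.suc-* (+ n) (⟦ P ⟧ f k)))

X^-act : ∀ n f k → ⟦ X ^ n ⟧ f k ≡ f (n ℕ.+ k)
X^-act zero    f k = ℤ.*-identityˡ (f k)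
X^-act (suc n) f k = trans (X^-act n f (suc k)) (cong f (ℕ.+-suc n k))

-- Factorials and binomial coefficients locally at p

/-unique : ∀ {s} k {q} .{{_ : NonZero q}} → s < q → (s ℕ.+ k ℕ.* q) ℕ./ q ≡ k
/-unique {s} k {q} s<q = trans (ℕ.+-distrib-/-∣ʳ s (ℕ.n∣m*n k))
  (cong₂ ℕ._+_ (ℕ.m<n⇒m/n≡0 s<q) (ℕ.m*n/n≡m k q))

C-absorb : ∀ n k → suc k ℕ.* (suc n C suc k) ≡ suc n ℕ.* (n C k)
C-absorb zero zero = refl
C-absorb zero (suc k) = ℕ.*-zeroʳ (suc (suc k))
C-absorb (suc n) zero = trans (ℕ.*-identityˡ _) (trans (sym (nCk+nC[k+1]≡[n+1]C[k+1] (suc n) 0))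
  (cong suc (trans (sym (ℕ.*-identityˡ _)) (C-absorb n 0))))
C-absorb (suc n) (suc k) = begin
  suc (suc k) ℕ.* (suc (suc n) C suc (suc k))
    ≡⟨ cong (suc (suc k) ℕ.*_) (nCk+nC[k+1]≡[n+1]C[k+1] (suc n) (suc k)) ⟨
  suc (suc k) ℕ.* (c ℕ.+ (suc n C suc (suc k)))
    ≡⟨ expand k c _ ⟩
  c ℕ.+ (suc k ℕ.* c ℕ.+ suc (suc k) ℕ.* (suc n C suc (suc k)))
    ≡⟨ cong (c ℕ.+_) (cong₂ ℕ._+_ (C-absorb n k) (C-absorb n (suc k))) ⟩
  c ℕ.+ (suc n ℕ.* (n C k) ℕ.+ suc n ℕ.* (n C suc k))
    ≡⟨ cong (c ℕ.+_) (ℕ.*-distribˡ-+ (suc n) (n C k) (n C suc k)) ⟨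
  c ℕ.+ suc n ℕ.* ((n C k) ℕ.+ (n C suc k))
    ≡⟨ cong (λ z → c ℕ.+ suc n ℕ.* z) (nCk+nC[k+1]≡[n+1]C[k+1] n k) ⟩
  suc (suc n) ℕ.* c ∎
  where
  open ≡-Reasoning
  c = suc n C suc k
  expand : ∀ k a b → suc (suc k) ℕ.* (a ℕ.+ b) ≡ a ℕ.+ (suc k ℕ.* a ℕ.+ suc (suc k) ℕ.* b)
  expand = ℕSolver.solve-∀

-- The quotient grows from `n` to `n + 1` only if `q` divides `n + 1`, and then the new factor of
-- the factorial divides `n + 1` as well.
[1+n/q]!∣ : ∀ n q .{{_ : NonZero q}} → (suc n ℕ./ q) ! ℕ.∣ suc n ℕ.* (n ℕ./ q) !
[1+n/q]!∣ n q with suc (n ℕ.% q) ℕ.≟ q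
... | yes eq = subst₂ (λ a b → a ! ℕ.∣ b ℕ.* k !) (sym (trans (cong (ℕ._/ q) 1+n≡) (ℕ.m*n/n≡m (suc k) q)))
                 (sym 1+n≡) (ℕ.*-monoˡ-∣ (k !) (ℕ.m∣m*n {suc k} q))
  where
  k = n ℕ./ q
  1+n≡ : suc n ≡ suc k ℕ.* q
  1+n≡ = trans (cong suc (ℕ.m≡m%n+[m/n]*n n q)) (cong (ℕ._+ k ℕ.* q) eq)
... | no neq = subst (λ a → a ! ℕ.∣ suc n ℕ.* k !)
                 (sym (trans (cong (λ a → suc a ℕ./ q) (ℕ.m≡m%n+[m/n]*n n q))
                   (/-unique k (ℕ.≤∧≢⇒< (ℕ.m%n<n n q) neq))))
                 (ℕ.n∣m*n (suc n))
  where k = n ℕ./ q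

-- `j ! * (n C j)` is the falling factorial n (n-1) ⋯ (n-j+1), so the previous lemma is iterated `j`
-- times. This lets a binomial coefficient make up for the smaller factorial that the j-th term of
-- the expansion provides.
[n/q]!∣ : ∀ {n j} q .{{_ : NonZero q}} → j ≤ n →
          (n ℕ./ q) ! ℕ.∣ j ! ℕ.* (n C j) ℕ.* ((n ℕ.∸ j) ℕ./ q) !
[n/q]!∣ {n} {zero} q z≤n = ℕ.∣-reflexive (sym (ℕ.*-identityˡ _))
[n/q]!∣ {suc n} {suc j} q (s≤s j≤n) = ℕ.∣-trans ([1+n/q]!∣ n q)
  (subst (suc n ℕ.* (n ℕ./ q) ! ℕ.∣_) regroup (ℕ.*-monoʳ-∣ (suc n) ([n/q]!∣ q j≤n)))
  where
  m = ((n ℕ.∸ j) ℕ./ q) !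
  arrange₁ : ∀ n a b c → n ℕ.* (a ℕ.* b ℕ.* c) ≡ a ℕ.* (n ℕ.* b) ℕ.* c
  arrange₁ = ℕSolver.solve-∀
  arrange₂ : ∀ j a b c → a ℕ.* (j ℕ.* b) ℕ.* c ≡ j ℕ.* a ℕ.* b ℕ.* c
  arrange₂ = ℕSolver.solve-∀
  regroup : suc n ℕ.* (j ! ℕ.* (n C j) ℕ.* m) ≡ suc j ! ℕ.* (suc n C suc j) ℕ.* m
  regroup = trans (arrange₁ (suc n) (j !) (n C j) m)
    (trans (cong (λ z → j ! ℕ.* z ℕ.* m) (sym (C-absorb n j)))
           (arrange₂ (suc j) (j !) (suc n C suc j) m))

module Local (p : ℕ) (pp : Prime p) where

  instance
    p≢0 : NonZero p
    p≢0 = prime⇒nonZero pp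

  1<p : 1 < p
  1<p = ℕ.nonTrivial⇒n>1 p {{prime⇒nonTrivial pp}}

  p∤1 : ¬ p ℕ.∣ 1
  p∤1 p∣1 = ℕ.<⇒≱ 1<p (ℕ.∣⇒≤ p∣1)

  p∤* : ∀ {a b} → ¬ p ℕ.∣ a → ¬ p ℕ.∣ b → ¬ p ℕ.∣ a ℕ.* b
  p∤* {a} {b} p∤a p∤b p∣ab with euclidsLemma a b pp p∣ab
  ... | inj₁ p∣a = p∤a p∣a
  ... | inj₂ p∣b = p∤b p∣b

  -- Divisibility in the localisation of ℤ at p.
  infix 4 _∣ₚ_
  record _∣ₚ_ (a b : ℤ) : Set where
    constructor local
    field
      unit    : ℕ
      p∤unit  : ¬ p ℕ.∣ unit
      divided : a ℤ∣.∣ + unit ℤ.* b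

  ∣⇒∣ₚ : ∀ {a b} → a ℤ∣.∣ b → a ∣ₚ b
  ∣⇒∣ₚ {b = b} d = local 1 p∤1 (subst (_ ℤ∣.∣_) (sym (ℤ.*-identityˡ b)) d)

  ∣ₚ-refl : ∀ {a} → a ∣ₚ a
  ∣ₚ-refl = ∣⇒∣ₚ ℤ∣.∣-refl

  ∣ₚ-*ˡ : ∀ {a b} c → a ∣ₚ b → a ∣ₚ c ℤ.* b
  ∣ₚ-*ˡ {a} {b} c (local u p∤u d) = local u p∤u (subst (a ℤ∣.∣_) (swap c (+ u) b) (ℤ∣.∣n⇒∣m*n c d))
    where
    swap : ∀ c u b → c ℤ.* (u ℤ.* b) ≡ u ℤ.* (c ℤ.* b)
    swap = solve-∀

  ∣ₚ-+ : ∀ {a b c} → a ∣ₚ b → a ∣ₚ c → a ∣ₚ b ℤ.+ c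
  ∣ₚ-+ {a} {b} {c} (local u p∤u d) (local v p∤v e) = local (u ℕ.* v) (p∤* p∤u p∤v)
    (subst (a ℤ∣.∣_) (trans (distr (+ u) (+ v) b c) (cong (ℤ._* (b ℤ.+ c)) (sym (ℤ.pos-* u v))))
      (ℤ∣.∣m∣n⇒∣m+n (ℤ∣.∣n⇒∣m*n (+ v) d) (ℤ∣.∣n⇒∣m*n (+ u) e)))
    where
    distr : ∀ u v b c → v ℤ.* (u ℤ.* b) ℤ.+ u ℤ.* (v ℤ.* c) ≡ u ℤ.* v ℤ.* (b ℤ.+ c)
    distr = solve-∀

  ∣ₚ-*-mono : ∀ {a b c d} → a ∣ₚ b → c ∣ₚ d → a ℤ.* c ∣ₚ b ℤ.* d
  ∣ₚ-*-mono {a} {b} {c} {d} (local u p∤u (divides k eq)) (local v p∤v (divides l eq′)) =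
    local (u ℕ.* v) (p∤* p∤u p∤v) (divides (k ℤ.* l) (begin
      + (u ℕ.* v) ℤ.* (b ℤ.* d)            ≡⟨ cong (ℤ._* (b ℤ.* d)) (ℤ.pos-* u v) ⟩
      + u ℤ.* + v ℤ.* (b ℤ.* d)            ≡⟨ interchange (+ u) (+ v) b d ⟩
      + u ℤ.* b ℤ.* (+ v ℤ.* d)            ≡⟨ cong₂ ℤ._*_ eq eq′ ⟩
      k ℤ.* a ℤ.* (l ℤ.* c)                ≡⟨ interchange k a l c ⟩
      k ℤ.* l ℤ.* (a ℤ.* c)                ∎))
    where
    open ≡-Reasoning
    interchange : ∀ a b c d → a ℤ.* b ℤ.* (c ℤ.* d) ≡ a ℤ.* c ℤ.* (b ℤ.* d)
    interchange = solve-∀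

  ∣ₚ-trans : ∀ {a b c} → a ∣ₚ b → b ∣ₚ c → a ∣ₚ c
  ∣ₚ-trans {a} {b} {c} (local u p∤u d) (local v p∤v (divides k eq)) = local (u ℕ.* v) (p∤* p∤u p∤v)
    (subst (a ℤ∣.∣_) (begin
      k ℤ.* (+ u ℤ.* b)       ≡⟨ swap k (+ u) b ⟩
      + u ℤ.* (k ℤ.* b)       ≡⟨ cong (ℤ._*_ (+ u)) eq ⟨
      + u ℤ.* (+ v ℤ.* c)     ≡⟨ ℤ.*-assoc (+ u) (+ v) c ⟨
      + u ℤ.* + v ℤ.* c       ≡⟨ cong (ℤ._* c) (ℤ.pos-* u v) ⟨
      + (u ℕ.* v) ℤ.* c       ∎) (ℤ∣.∣n⇒∣m*n k d))
    where
    open ≡-Reasoning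
    swap : ∀ c u b → c ℤ.* (u ℤ.* b) ≡ u ℤ.* (c ℤ.* b)
    swap = solve-∀

  ∣ₚ-cancelˡ : ∀ c .{{_ : ℤ.NonZero c}} {a b} → c ℤ.* a ∣ₚ c ℤ.* b → a ∣ₚ b
  ∣ₚ-cancelˡ c {a} {b} (local u p∤u d) =
    local u p∤u (ℤ∣.*-cancelˡ-∣ c (subst (c ℤ.* a ℤ∣.∣_) (swap c (+ u) b) d))
    where
    swap : ∀ c u b → u ℤ.* (c ℤ.* b) ≡ c ℤ.* (u ℤ.* b)
    swap = solve-∀

  ∣ₚ-unitˡ : ∀ {u} → ¬ p ℕ.∣ u → + u ∣ₚ 1ℤ
  ∣ₚ-unitˡ {u} p∤u = local u p∤u (ℤ∣.∣-reflexive (sym (ℤ.*-identityʳ (+ u))))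

  ∣ₚ-dropˡ : ∀ {u} → ¬ p ℕ.∣ u → ∀ {a b} → a ∣ₚ + u ℤ.* b → a ∣ₚ b
  ∣ₚ-dropˡ {u} p∤u {a} {b} d =
    ∣ₚ-trans d (subst (+ u ℤ.* b ∣ₚ_) (ℤ.*-identityˡ b) (∣ₚ-*-mono (∣ₚ-unitˡ p∤u) ∣ₚ-refl))

  infix 4 _∣ₙ_
  _∣ₙ_ : ℕ → ℕ → Set
  a ∣ₙ b = + a ∣ₚ + b

  ∣⇒∣ₙ : ∀ {a b} → a ℕ.∣ b → a ∣ₙ b
  ∣⇒∣ₙ d = ∣⇒∣ₚ (ℤ∣.∣ᵤ⇒∣ d)

  ∣ₙ-*-mono : ∀ {a b c d} → a ∣ₙ b → c ∣ₙ d → a ℕ.* c ∣ₙ b ℕ.* d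
  ∣ₙ-*-mono {a} {b} {c} {d} x y =
    subst₂ _∣ₚ_ (sym (ℤ.pos-* a c)) (sym (ℤ.pos-* b d)) (∣ₚ-*-mono x y)

  p∤s+mp : ∀ {s} m → suc s < p → ¬ p ℕ.∣ suc s ℕ.+ m ℕ.* p
  p∤s+mp {s} m s<p d = ℕ.<⇒≱ s<p (ℕ.∣⇒≤ (ℕ.∣m+n∣m⇒∣n
    (subst (p ℕ.∣_) (ℕ.+-comm (suc s) (m ℕ.* p)) d) (ℕ.n∣m*n m)))

  -- Factors of the factorial prime to p are units, and its multiples of p multiply to p^m m!. The
  -- recursion strips units until `s` is 0, then splits off a multiple of p and restarts with
  -- `s = p - 1`.
  n!∣p^m*m! : ∀ m {s} → s < p → (s ℕ.+ m ℕ.* p) ! ∣ₙ p ℕ.^ m ℕ.* m !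
  n!∣p^m*m! m {suc s} s<p = subst ((suc s ℕ.+ m ℕ.* p) ! ∣ₙ_) (ℕ.*-identityˡ _)
    (∣ₙ-*-mono (∣ₚ-unitˡ (p∤s+mp m s<p)) (n!∣p^m*m! m (ℕ.<-trans (ℕ.n<1+n s) s<p)))
  n!∣p^m*m! zero    {zero} s<p = ∣ₚ-refl
  n!∣p^m*m! (suc m) {zero} s<p = step p refl
    where
    arrange : ∀ p m a b → (p ℕ.+ m ℕ.* p) ℕ.* (a ℕ.* b) ≡ p ℕ.* a ℕ.* (b ℕ.+ m ℕ.* b)
    arrange = ℕSolver.solve-∀
    -- `p` is a variable here; replacing it by `r` and matching on `r` exposes a successor, so that
    -- the factorial unfolds.
    step : ∀ r → r ≡ p → (r ℕ.+ m ℕ.* p) ! ∣ₙ p ℕ.^ suc m ℕ.* suc m !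
    step zero    eq = contradiction (sym eq) (ℕ.>⇒≢ (ℕ.≤-trans (s≤s z≤n) 1<p))
    step (suc r) eq = subst ((suc r ℕ.+ m ℕ.* p) ! ∣ₙ_)
      (trans (cong (λ z → (z ℕ.+ m ℕ.* p) ℕ.* (p ℕ.^ m ℕ.* m !)) eq) (arrange p m (p ℕ.^ m) (m !)))
      (∣ₙ-*-mono (∣ₚ-refl {+ (suc r ℕ.+ m ℕ.* p)}) (n!∣p^m*m! m (ℕ.≤-reflexive eq)))

  p^-∣ₙ : ∀ {a b} → a ≤ b → p ℕ.^ a ∣ₙ p ℕ.^ b
  p^-∣ₙ {a} {b} a≤b = ∣⇒∣ₙ (ℕ.divides (p ℕ.^ (b ℕ.∸ a))
    (trans (cong (p ℕ.^_) (sym (ℕ.m∸n+n≡m a≤b))) (ℕ.^-distribˡ-+-* p (b ℕ.∸ a) a)))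

  -- Up to units (n+1)! is p^(m+1) (m+1)! with m + 1 = ⌊(n+1)/p⌋, and recursion bounds (m+1)! by
  -- p^m. The total exponent 2m + 1 is at most n because p ≥ 2. If the quotient is 0, the factorial
  -- is itself a unit.
  1+n!∣p^n : ∀ n → suc n ! ∣ₙ p ℕ.^ n
  1+n!∣p^n = <-rec _ go
    where
    go : ∀ n → (∀ {m} → m < n → suc m ! ∣ₙ p ℕ.^ m) → suc n ! ∣ₙ p ℕ.^ n
    go n rec with suc n ℕ./ p | suc n ℕ.% p | ℕ.m≡m%n+[m/n]*n (suc n) p | ℕ.m%n<n (suc n) p
    ... | zero  | s | eq | s<p = ∣ₚ-trans
      (subst (λ z → z ! ∣ₙ 1) (sym eq) (n!∣p^m*m! 0 s<p)) (p^-∣ₙ {0} {n} z≤n)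
    ... | suc m | s | eq | s<p = ∣ₚ-trans
      (subst (λ z → z ! ∣ₙ p ℕ.^ suc m ℕ.* suc m !) (sym eq) (n!∣p^m*m! (suc m) s<p))
      (∣ₚ-trans (∣ₙ-*-mono (∣ₚ-refl {+ (p ℕ.^ suc m)}) (rec m<n))
        (subst (_∣ₙ p ℕ.^ n) (ℕ.^-distribˡ-+-* p (suc m) m) (p^-∣ₙ 2m<n)))
      where
      open ℕ.≤-Reasoning
      double : ∀ m → suc (suc m ℕ.+ m) ≡ suc m ℕ.* 2
      double = ℕSolver.solve-∀
      2m<n : suc m ℕ.+ m ≤ n
      2m<n = ℕ.s≤s⁻¹ (begin
        suc (suc m ℕ.+ m)      ≡⟨ double m ⟩
        suc m ℕ.* 2            ≤⟨ ℕ.*-monoʳ-≤ (suc m) 1<p ⟩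
        suc m ℕ.* p            ≤⟨ ℕ.m≤n+m (suc m ℕ.* p) s ⟩
        s ℕ.+ suc m ℕ.* p      ≡⟨ eq ⟨
        suc n                  ∎)
      m<n : m < n
      m<n = ℕ.≤-trans (ℕ.m≤m+n (suc m) m) 2m<n

  n!∣p^n : ∀ n → n ! ∣ₙ p ℕ.^ n
  n!∣p^n zero    = ∣ₚ-refl
  n!∣p^n (suc n) = ∣ₚ-trans (1+n!∣p^n n) (p^-∣ₙ (ℕ.n≤1+n n))

  -- With m + 1 = ⌊j/p⌋ the p-adic valuation of j! is at most (m+1) + m, by the two preceding
  -- estimates. What remains is a linear inequality, taken as a hypothesis for every `m` with (m+1)
  -- p ≤ j so that callers need no division.
  p^a*j!∣p^j : ∀ {a j} → a ≤ j → (∀ m → suc m ℕ.* p ≤ j → a ℕ.+ (suc m ℕ.+ m) ≤ j) →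
               p ℕ.^ a ℕ.* j ! ∣ₙ p ℕ.^ j
  p^a*j!∣p^j {a} {j} a≤j bound
    with j ℕ./ p | j ℕ.% p | ℕ.m≡m%n+[m/n]*n j p | ℕ.m%n<n j p
  ... | zero  | s | eq | s<p = ∣ₚ-trans
    (∣ₙ-*-mono (p^-∣ₙ a≤j) (subst (λ z → z ! ∣ₙ 1) (sym eq) (n!∣p^m*m! 0 s<p)))
    (∣⇒∣ₙ (ℕ.∣-reflexive (ℕ.*-identityʳ _)))
  ... | suc m | s | eq | s<p = ∣ₚ-trans
    (∣ₙ-*-mono (∣ₚ-refl {+ (p ℕ.^ a)})
      (∣ₚ-trans (subst (λ z → z ! ∣ₙ p ℕ.^ suc m ℕ.* suc m !) (sym eq) (n!∣p^m*m! (suc m) s<p))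
        (∣ₙ-*-mono (∣ₚ-refl {+ (p ℕ.^ suc m)}) (1+n!∣p^n m))))
    (subst (_∣ₙ p ℕ.^ j)
      (trans (ℕ.^-distribˡ-+-* p a (suc m ℕ.+ m)) (cong (p ℕ.^ a ℕ.*_) (ℕ.^-distribˡ-+-* p (suc m) m)))
      (p^-∣ₙ (bound m (ℕ.≤-trans (ℕ.m≤n+m (suc m ℕ.* p) s) (ℕ.≤-reflexive (sym eq))))))

-- Powers of 1 - X

C-! : ∀ {m i} → i ≤ m → (m C i) ℕ.* (i ! ℕ.* (m ℕ.∸ i) !) ≡ m !
C-! {m} {i} i≤m = trans (cong (ℕ._* (i ! ℕ.* (m ℕ.∸ i) !)) (nCk≡n!/k![n-k]! i≤m))
                    (ℕ.m/n*n≡m (k![n∸k]!∣n! i≤m))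
  where instance _ = i ℕ.!* (m ℕ.∸ i) !≢0

nat : ℕ → Poly
nat n = const (+ n)

nat-* : ∀ a b → nat (a ℕ.* b) ≈ₚ nat a * nat b
nat-* a b = pointwise λ f k → trans (cong (ℤ._* f k) (ℤ.pos-* a b)) (ℤ.*-assoc (+ a) (+ b) (f k))

nat-^ : ∀ a n → nat a ^ n ≈ₚ nat (a ℕ.^ n)
nat-^ a zero    = ≈-refl
nat-^ a (suc n) = ≈-trans (*-congˡ {nat a} (nat-^ a n)) (≈-sym (nat-* a (a ℕ.^ n)))

*-^ : ∀ P Q n → (P * Q) ^ n ≈ₚ P ^ n * Q ^ n
*-^ P Q zero    = ≈-sym (*-identityˡ 1#)
*-^ P Q (suc n) = ≈-trans (*-congˡ {P * Q} (*-^ P Q n))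
  (solve 4 (λ a b c d → (a :* b) :* (c :* d) := (a :* c) :* (b :* d)) ≈-refl P Q (P ^ n) (Q ^ n))

sum-preserves : ∀ (T : Poly → Set) → T 0# → (∀ {P Q} → T P → T Q → T (P + Q)) →
                ∀ {n} (v : Fin n → Poly) → (∀ i → T (v i)) → T (sum v)
sum-preserves T T0 T+ {zero}  v Tv = T0
sum-preserves T T0 T+ {suc n} v Tv =
  T+ (Tv Fin.zero) (sum-preserves T T0 T+ (v ∘ Fin.suc) (Tv ∘ Fin.suc))

1-X^-act : ∀ s f k → ⟦ 1# - X ^ s ⟧ f k ≡ f k ℤ.- f (s ℕ.+ k)
1-X^-act s f k = trans (cong (λ z → 1ℤ ℤ.* f k ℤ.+ -1ℤ ℤ.* z) (X^-act s f k)) (tidy (f k) (f (s ℕ.+ k)))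
  where
  tidy : ∀ a b → 1ℤ ℤ.* a ℤ.+ -1ℤ ℤ.* b ≡ a ℤ.- b
  tidy = solve-∀

⟦⟧-zero : ∀ P {f} → (∀ k → f k ≡ 0ℤ) → ∀ k → ⟦ P ⟧ f k ≡ 0ℤ
⟦⟧-zero P {f} f≡0 k = trans (⟦⟧-cong P f≡0 k) (⟦⟧-* P 0ℤ (λ _ → 0ℤ) k)

⟦⟧-shift : ∀ P f s k → ⟦ P ⟧ (λ i → f (s ℕ.+ i)) k ≡ ⟦ P ⟧ f (s ℕ.+ k)
⟦⟧-shift P f zero    k = refl
⟦⟧-shift P f (suc s) k = trans (⟦⟧-shift P (f ∘ suc) s k) (⟦⟧-suc P f (s ℕ.+ k))

module _ (s : ℕ) (h : ℤ) (y : ℕ → ℤ) (y-shift : ∀ k → y (s ℕ.+ k) ≡ y k ℤ.+ h) where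

  private
    ∇ : Poly
    ∇ = 1# - X ^ s

  -- The difference of `y` is constant, so its higher differences vanish and only two terms of the
  -- product rule survive. The factor (a+1) h in the second one is the source of p^a a! below.
  leibniz : ∀ f a k → ⟦ ∇ ^ suc a ⟧ (λ i → y i ℤ.* f i) k ≡
            y k ℤ.* ⟦ ∇ ^ suc a ⟧ f k ℤ.- + suc a ℤ.* h ℤ.* ⟦ ∇ ^ a ⟧ f (s ℕ.+ k)
  leibniz f zero k = begin
    ⟦ ∇ ⟧ (⟦ 1# ⟧ (λ i → y i ℤ.* f i)) k
      ≡⟨ 1-X^-act s (⟦ 1# ⟧ (λ i → y i ℤ.* f i)) k ⟩
    1ℤ ℤ.* (y k ℤ.* f k) ℤ.- 1ℤ ℤ.* (y (s ℕ.+ k) ℤ.* f (s ℕ.+ k))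
      ≡⟨ cong (λ z → 1ℤ ℤ.* (y k ℤ.* f k) ℤ.- 1ℤ ℤ.* (z ℤ.* f (s ℕ.+ k))) (y-shift k) ⟩
    1ℤ ℤ.* (y k ℤ.* f k) ℤ.- 1ℤ ℤ.* ((y k ℤ.+ h) ℤ.* f (s ℕ.+ k))
      ≡⟨ tidy (y k) h (f k) (f (s ℕ.+ k)) ⟩
    y k ℤ.* (1ℤ ℤ.* f k ℤ.- 1ℤ ℤ.* f (s ℕ.+ k)) ℤ.- 1ℤ ℤ.* h ℤ.* (1ℤ ℤ.* f (s ℕ.+ k))
      ≡⟨ cong (λ z → y k ℤ.* z ℤ.- 1ℤ ℤ.* h ℤ.* (1ℤ ℤ.* f (s ℕ.+ k))) (1-X^-act s (⟦ 1# ⟧ f) k) ⟨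
    y k ℤ.* ⟦ ∇ ⟧ (⟦ 1# ⟧ f) k ℤ.- 1ℤ ℤ.* h ℤ.* (1ℤ ℤ.* f (s ℕ.+ k)) ∎
    where
    open ≡-Reasoning
    tidy : ∀ y h a b → 1ℤ ℤ.* (y ℤ.* a) ℤ.- 1ℤ ℤ.* ((y ℤ.+ h) ℤ.* b) ≡
           y ℤ.* (1ℤ ℤ.* a ℤ.- 1ℤ ℤ.* b) ℤ.- 1ℤ ℤ.* h ℤ.* (1ℤ ℤ.* b)
    tidy = solve-∀
  leibniz f (suc a) k = begin
    ⟦ ∇ ⟧ (⟦ ∇ ^ suc a ⟧ (λ i → y i ℤ.* f i)) k
      ≡⟨ ⟦⟧-cong ∇ (leibniz f a) k ⟩
    ⟦ ∇ ⟧ (λ i → y i ℤ.* F₁ i ℤ.- c ℤ.* F₀ (s ℕ.+ i)) k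
      ≡⟨ 1-X^-act s (λ i → y i ℤ.* F₁ i ℤ.- c ℤ.* F₀ (s ℕ.+ i)) k ⟩
    y k ℤ.* F₁ k ℤ.- c ℤ.* F₀ k′ ℤ.- (y k′ ℤ.* F₁ k′ ℤ.- c ℤ.* F₀ (s ℕ.+ k′))
      ≡⟨ cong (λ z → y k ℤ.* F₁ k ℤ.- c ℤ.* F₀ k′ ℤ.- (z ℤ.* F₁ k′ ℤ.- c ℤ.* F₀ (s ℕ.+ k′))) (y-shift k) ⟩
    y k ℤ.* F₁ k ℤ.- c ℤ.* F₀ k′ ℤ.- ((y k ℤ.+ h) ℤ.* F₁ k′ ℤ.- c ℤ.* F₀ (s ℕ.+ k′))
      ≡⟨ tidy (y k) (F₁ k) (F₁ k′) c (F₀ k′) (F₀ (s ℕ.+ k′)) h ⟩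
    y k ℤ.* (F₁ k ℤ.- F₁ k′) ℤ.- (h ℤ.* F₁ k′ ℤ.+ c ℤ.* (F₀ k′ ℤ.- F₀ (s ℕ.+ k′)))
      ≡⟨ cong₂ (λ u v → y k ℤ.* u ℤ.- (h ℤ.* F₁ k′ ℤ.+ c ℤ.* v)) (1-X^-act s F₁ k) (1-X^-act s F₀ k′) ⟨
    y k ℤ.* ⟦ ∇ ⟧ F₁ k ℤ.- (h ℤ.* F₁ k′ ℤ.+ + suc a ℤ.* h ℤ.* F₁ k′)
      ≡⟨ cong (ℤ._-_ (y k ℤ.* ⟦ ∇ ⟧ F₁ k)) (collect (+ suc a) h (F₁ k′)) ⟩
    y k ℤ.* ⟦ ∇ ⟧ F₁ k ℤ.- (1ℤ ℤ.+ + suc a) ℤ.* h ℤ.* F₁ k′ ∎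
    where
    open ≡-Reasoning
    F₁ = ⟦ ∇ ^ suc a ⟧ f
    F₀ = ⟦ ∇ ^ a ⟧ f
    k′ = s ℕ.+ k
    c = + suc a ℤ.* h
    tidy : ∀ y g g′ c f f′ h → y ℤ.* g ℤ.- c ℤ.* f ℤ.- ((y ℤ.+ h) ℤ.* g′ ℤ.- c ℤ.* f′) ≡
           y ℤ.* (g ℤ.- g′) ℤ.- (h ℤ.* g′ ℤ.+ c ℤ.* (f ℤ.- f′))
    tidy = solve-∀
    collect : ∀ a h g → h ℤ.* g ℤ.+ a ℤ.* h ℤ.* g ≡ (1ℤ ℤ.+ a) ℤ.* h ℤ.* g
    collect = solve-∀

module _ {p : ℕ} {pp : Prime p} where

  open Local p pp

  ∣ₚ-⟦⟧ : ∀ {d f} P → (∀ k → d ∣ₚ f k) → ∀ k → d ∣ₚ ⟦ P ⟧ f k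
  ∣ₚ-⟦⟧ (const c) df k = ∣ₚ-*ˡ c (df k)
  ∣ₚ-⟦⟧ X         df k = df (suc k)
  ∣ₚ-⟦⟧ (P ⊕ Q)   df k = ∣ₚ-+ (∣ₚ-⟦⟧ P df k) (∣ₚ-⟦⟧ Q df k)
  ∣ₚ-⟦⟧ (P ⊗ Q)   df k = ∣ₚ-⟦⟧ P (∣ₚ-⟦⟧ Q df) k

-- Divisibility of operators on polynomials in `y` times a periodic sequence

module Ideal (p : ℕ) (pp : Prime p) (s : ℕ) (y e : ℕ → ℤ)
  (y-shift : ∀ k → y (s ℕ.+ k) ≡ y k ℤ.+ + p) (e-shift : ∀ k → e (s ℕ.+ k) ≡ e k) where

  open Local p pp

  ∇ : Poly
  ∇ = 1# - X ^ s

  -- Its members are the polynomials in `y` times `e`. The constructors are the operations through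
  -- which the quotients in `divided-∇` are built; `shift` is there because of the shifted term of
  -- `leibniz`.
  data 𝒞 : (ℕ → ℤ) → Set where
    base  : 𝒞 e
    times : ∀ {f} → 𝒞 f → 𝒞 (λ k → y k ℤ.* f k)
    plus  : ∀ {f g} → 𝒞 f → 𝒞 g → 𝒞 (λ k → f k ℤ.+ g k)
    scale : ∀ c {f} → 𝒞 f → 𝒞 (λ k → c ℤ.* f k)
    shift : ∀ {f} → 𝒞 f → 𝒞 (λ k → f (s ℕ.+ k))

  -- Differences of `e` vanish by periodicity. For a product with `y`, `leibniz` combines p^(a+1)
  -- (a+1)! with (a+1) p times p^a a!, which are equal divisors. That the quotient lies in `𝒞` again
  -- allows a second operator's divisor to be applied to it.
  divided-∇ : ∀ a {f} → 𝒞 f → ∃[ g ] 𝒞 g × (∀ k → ⟦ ∇ ^ a ⟧ f k ≡ + (p ℕ.^ a ℕ.* a !) ℤ.* g k)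
  divided-∇ zero    {f} Cf = f , Cf , λ k → refl
  -- The quotient is the zero sequence, written as a member of `𝒞`.
  divided-∇ (suc a) base = _ , scale 0ℤ base , λ k → begin
    ⟦ ∇ ⟧ (⟦ ∇ ^ a ⟧ e) k    ≡⟨ ⟦⟧-comm ∇ (∇ ^ a) e k ⟩
    ⟦ ∇ ^ a ⟧ (⟦ ∇ ⟧ e) k    ≡⟨ ⟦⟧-zero (∇ ^ a) ∇e≡0 k ⟩
    0ℤ                       ≡⟨ ℤ.*-zeroʳ (+ (p ℕ.^ suc a ℕ.* suc a !)) ⟨
    + (p ℕ.^ suc a ℕ.* suc a !) ℤ.* (0ℤ ℤ.* e k) ∎
    where
    open ≡-Reasoning
    ∇e≡0 : ∀ k → ⟦ ∇ ⟧ e k ≡ 0ℤ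
    ∇e≡0 k = trans (1-X^-act s e k) (ℤ.i≡j⇒i-j≡0 (sym (e-shift k)))
  divided-∇ (suc a) (times {f} Cf) with divided-∇ (suc a) Cf | divided-∇ a Cf
  ... | g₁ , Cg₁ , eq₁ | g₀ , Cg₀ , eq₀ = _ , plus (times Cg₁) (scale -1ℤ (shift Cg₀)) , λ k → begin
    ⟦ ∇ ^ suc a ⟧ (λ i → y i ℤ.* f i) k
      ≡⟨ leibniz s (+ p) y y-shift f a k ⟩
    y k ℤ.* ⟦ ∇ ^ suc a ⟧ f k ℤ.- + suc a ℤ.* + p ℤ.* ⟦ ∇ ^ a ⟧ f (s ℕ.+ k)
      ≡⟨ cong₂ (λ u v → y k ℤ.* u ℤ.- + suc a ℤ.* + p ℤ.* v) (eq₁ k) (eq₀ (s ℕ.+ k)) ⟩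
    y k ℤ.* (c₁ ℤ.* g₁ k) ℤ.- + suc a ℤ.* + p ℤ.* (c₀ ℤ.* g₀ (s ℕ.+ k))
      ≡⟨ cong (ℤ._-_ (y k ℤ.* (c₁ ℤ.* g₁ k))) (sym (ℤ.*-assoc (+ suc a ℤ.* + p) c₀ _)) ⟩
    y k ℤ.* (c₁ ℤ.* g₁ k) ℤ.- + suc a ℤ.* + p ℤ.* c₀ ℤ.* g₀ (s ℕ.+ k)
      ≡⟨ cong (λ z → y k ℤ.* (c₁ ℤ.* g₁ k) ℤ.- z ℤ.* g₀ (s ℕ.+ k)) c₁≡ ⟩
    y k ℤ.* (c₁ ℤ.* g₁ k) ℤ.- c₁ ℤ.* g₀ (s ℕ.+ k)
      ≡⟨ tidy (y k) c₁ (g₁ k) _ ⟩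
    c₁ ℤ.* (y k ℤ.* g₁ k ℤ.+ -1ℤ ℤ.* g₀ (s ℕ.+ k)) ∎
    where
    open ≡-Reasoning
    c₁ = + (p ℕ.^ suc a ℕ.* suc a !)
    c₀ = + (p ℕ.^ a ℕ.* a !)
    arrange : ∀ a p b c → a ℕ.* p ℕ.* (b ℕ.* c) ≡ p ℕ.* b ℕ.* (a ℕ.* c)
    arrange = ℕSolver.solve-∀
    c₁≡ : + suc a ℤ.* + p ℤ.* c₀ ≡ c₁
    c₁≡ = trans (cong (ℤ._* c₀) (sym (ℤ.pos-* (suc a) p))) (trans (sym (ℤ.pos-* (suc a ℕ.* p) _))
      (cong +_ (arrange (suc a) p (p ℕ.^ a) (a !))))
    tidy : ∀ y c g g′ → y ℤ.* (c ℤ.* g) ℤ.- c ℤ.* g′ ≡ c ℤ.* (y ℤ.* g ℤ.+ -1ℤ ℤ.* g′)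
    tidy = solve-∀
  divided-∇ a@(suc _) (plus {f} {f′} Cf Cf′) with divided-∇ a Cf | divided-∇ a Cf′
  ... | g , Cg , eq | g′ , Cg′ , eq′ = _ , plus Cg Cg′ , λ k →
    trans (⟦⟧-+ (∇ ^ a) f f′ k) (trans (cong₂ ℤ._+_ (eq k) (eq′ k)) (sym (ℤ.*-distribˡ-+ (+ (p ℕ.^ a ℕ.* a !)) _ _)))
  divided-∇ a@(suc _) (scale c {f} Cf) with divided-∇ a Cf
  ... | g , Cg , eq = _ , scale c Cg , λ k →
    trans (⟦⟧-* (∇ ^ a) c f k) (trans (cong (ℤ._*_ c) (eq k)) (swap c (+ (p ℕ.^ a ℕ.* a !)) (g k)))
    where
    swap : ∀ a b c → a ℤ.* (b ℤ.* c) ≡ b ℤ.* (a ℤ.* c)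
    swap = solve-∀
  divided-∇ a@(suc _) (shift {f} Cf) with divided-∇ a Cf
  ... | g , Cg , eq = _ , shift Cg , λ k → trans (⟦⟧-shift (∇ ^ a) f s k) (eq (s ℕ.+ k))

  -- For each d the polynomials P with d ∣𝒞 P form an ideal.
  infix 4 _∣𝒞_
  record _∣𝒞_ (d : ℕ) (P : Poly) : Set where
    constructor divides-values
    field on : ∀ {f} → 𝒞 f → ∀ k → + d ∣ₚ ⟦ P ⟧ f k
  open _∣𝒞_

  1∣𝒞 : ∀ P → 1 ∣𝒞 P
  1∣𝒞 P = divides-values λ {f} _ k → ∣⇒∣ₚ (divides (⟦ P ⟧ f k) (sym (ℤ.*-identityʳ _)))

  ∣𝒞-resp : ∀ {d P Q} → P ≈ₚ Q → d ∣𝒞 P → d ∣𝒞 Q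
  ∣𝒞-resp {d} P≈Q dP = divides-values λ {f} Cf k → subst (+ d ∣ₚ_) (at P≈Q f k) (on dP Cf k)

  ∣𝒞-weaken : ∀ {c d P} → c ∣ₙ d → d ∣𝒞 P → c ∣𝒞 P
  ∣𝒞-weaken c∣d dP = divides-values λ Cf k → ∣ₚ-trans c∣d (on dP Cf k)

  ∣𝒞-+ : ∀ {d P Q} → d ∣𝒞 P → d ∣𝒞 Q → d ∣𝒞 P + Q
  ∣𝒞-+ dP dQ = divides-values λ Cf k → ∣ₚ-+ (on dP Cf k) (on dQ Cf k)

  ∣𝒞-*ˡ : ∀ {d} P {Q} → d ∣𝒞 Q → d ∣𝒞 P * Q
  ∣𝒞-*ˡ P dQ = divides-values λ Cf → ∣ₚ-⟦⟧ P (on dQ Cf)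

  ∣𝒞-nat : ∀ c {d P} → d ∣𝒞 P → c ℕ.* d ∣𝒞 nat c * P
  ∣𝒞-nat c {d} dP = divides-values λ Cf k →
    subst (_∣ₚ _) (sym (ℤ.pos-* c d)) (∣ₚ-*-mono (∣ₚ-refl {+ c}) (on dP Cf k))

  -- Operators commute, so `P` may act on the quotient of `∇ ^ a` from `divided-∇`; the two divisors
  -- then multiply.
  ∣𝒞-∇ : ∀ a {d P} → d ∣𝒞 P → p ℕ.^ a ℕ.* a ! ℕ.* d ∣𝒞 ∇ ^ a * P
  ∣𝒞-∇ a {d} {P} dP = divides-values result
    where
    c = + (p ℕ.^ a ℕ.* a !)
    result : ∀ {f} → 𝒞 f → ∀ k → _ ∣ₚ ⟦ ∇ ^ a ⟧ (⟦ P ⟧ f) k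
    result {f} Cf k with divided-∇ a Cf
    ... | g , Cg , eq = subst₂ _∣ₚ_ (sym (ℤ.pos-* (p ℕ.^ a ℕ.* a !) d))
      (sym (trans (⟦⟧-comm (∇ ^ a) P f k) (trans (⟦⟧-cong P eq k) (⟦⟧-* P c g k))))
      (∣ₚ-*-mono (∣ₚ-refl {c}) (on dP Cg k))

  -- The binomial coefficient turns i! j! into m!, as in a system of divided powers.
  ∣𝒞-binomial : ∀ c {A B} m → (∀ i j → i ℕ.+ j ≡ m → c ℕ.* (i ! ℕ.* j !) ∣𝒞 A ^ i * B ^ j) →
                c ℕ.* m ! ∣𝒞 (A + B) ^ m
  ∣𝒞-binomial c {A} {B} m hyp = ∣𝒞-resp (≈-sym (Binomial.theorem commutativeSemiring m A B))
    (sum-preserves (c ℕ.* m ! ∣𝒞_) (divides-values λ {f} _ k → ∣⇒∣ₚ (divides 0ℤ refl))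
      ∣𝒞-+ _ term)
    where
    arrange : ∀ a b c → a ℕ.* (b ℕ.* c) ≡ b ℕ.* (a ℕ.* c)
    arrange = ℕSolver.solve-∀
    term : ∀ (i : Fin (suc m)) → c ℕ.* m ! ∣𝒞 (m C toℕ i) · (A ^ toℕ i * B ^ (m ℕ.∸ toℕ i))
    term i = ∣𝒞-resp (pointwise λ f k → sym (·-act (m C toℕ i) _ f k))
      (subst (_∣𝒞 nat (m C toℕ i) * (A ^ toℕ i * B ^ (m ℕ.∸ toℕ i)))
        (trans (arrange (m C toℕ i) c _) (cong (c ℕ.*_) (C-! i≤m)))
        (∣𝒞-nat (m C toℕ i) (hyp (toℕ i) (m ℕ.∸ toℕ i) (ℕ.m+[n∸m]≡n i≤m))))
      where i≤m = ℕ.s≤s⁻¹ (toℕ<n i)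

  module _ {w U K : Poly} (w^p : w ^ p ≈ₚ ∇ + (nat p * (w * U) + nat p * (nat p * K))) where

    private
      B₁ B₂ : Poly
      B₁ = nat p * (w * U)
      B₂ = nat p * (nat p * K)

      -- The product carries p^i p^(2j): p^(i+j) is kept and the other p^j is spent on j!. The
      -- factor i! comes from `w ^ i`.
      B₁B₂ : ∀ i j {n} → i ℕ.+ j ≡ n → i ! ∣𝒞 w ^ i → p ℕ.^ n ℕ.* (i ! ℕ.* j !) ∣𝒞 B₁ ^ i * B₂ ^ j
      B₁B₂ i j refl dw = ∣𝒞-resp (≈-sym expand)
        (∣𝒞-weaken (subst₂ _∣ₙ_ lhs rhs
            (∣ₙ-*-mono (∣ₚ-refl {+ (p ℕ.^ i ℕ.* p ℕ.^ j ℕ.* i !)}) (n!∣p^n j)))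
          (∣𝒞-nat (p ℕ.^ i) (∣𝒞-nat (p ℕ.^ j) (∣𝒞-nat (p ℕ.^ j) (∣𝒞-*ˡ (U ^ i * K ^ j) dw)))))
        where
        arr₁ : ∀ a b c d → a ℕ.* b ℕ.* c ℕ.* d ≡ a ℕ.* b ℕ.* (c ℕ.* d)
        arr₁ = ℕSolver.solve-∀
        lhs : p ℕ.^ i ℕ.* p ℕ.^ j ℕ.* i ! ℕ.* j ! ≡ p ℕ.^ (i ℕ.+ j) ℕ.* (i ! ℕ.* j !)
        lhs = trans (arr₁ (p ℕ.^ i) (p ℕ.^ j) (i !) (j !))
          (cong (ℕ._* (i ! ℕ.* j !)) (sym (ℕ.^-distribˡ-+-* p i j)))
        arr₂ : ∀ a b c → a ℕ.* b ℕ.* c ℕ.* b ≡ a ℕ.* (b ℕ.* (b ℕ.* c))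
        arr₂ = ℕSolver.solve-∀
        rhs : p ℕ.^ i ℕ.* p ℕ.^ j ℕ.* i ! ℕ.* p ℕ.^ j ≡ p ℕ.^ i ℕ.* (p ℕ.^ j ℕ.* (p ℕ.^ j ℕ.* i !))
        rhs = arr₂ (p ℕ.^ i) (p ℕ.^ j) (i !)
        open ≈-Reasoning
        expand : B₁ ^ i * B₂ ^ j ≈ₚ nat (p ℕ.^ i) * (nat (p ℕ.^ j) * (nat (p ℕ.^ j) * ((U ^ i * K ^ j) * w ^ i)))
        expand = begin
          B₁ ^ i * B₂ ^ j
            ≈⟨ *-cong (≈-trans (*-^ (nat p) (w * U) i) (*-cong (nat-^ p i) (*-^ w U i)))
                      (≈-trans (*-^ (nat p) (nat p * K) j) (*-cong (nat-^ p j)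
                        (≈-trans (*-^ (nat p) K j) (*-congʳ (nat-^ p j))))) ⟩
          (nat (p ℕ.^ i) * (w ^ i * U ^ i)) * (nat (p ℕ.^ j) * (nat (p ℕ.^ j) * K ^ j))
            ≈⟨ solve 5 (λ a b w u k → (a :* (w :* u)) :* (b :* (b :* k)) :=
                                      a :* (b :* (b :* ((u :* k) :* w)))) ≈-refl
                 (nat (p ℕ.^ i)) (nat (p ℕ.^ j)) (w ^ i) (U ^ i) (K ^ j) ⟩
          nat (p ℕ.^ i) * (nat (p ℕ.^ j) * (nat (p ℕ.^ j) * ((U ^ i * K ^ j) * w ^ i))) ∎

    -- With n = r + m p, write w^n as w^r (∇ + B₁ + B₂)^m. Powers of ∇ are handled by `∣𝒞-∇`, those
    -- of B₁ by recursion, since they contain w only to exponents at most m < n. The result p^m m!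
    -- is n! up to a unit.
    n!∣𝒞w^n : ∀ n → n ! ∣𝒞 w ^ n
    n!∣𝒞w^n = <-rec _ go
      where
      go : ∀ n → (∀ {i} → i < n → i ! ∣𝒞 w ^ i) → n ! ∣𝒞 w ^ n
      go zero      rec = 1∣𝒞 _
      go n@(suc _) rec = ∣𝒞-resp split
        (∣𝒞-weaken (subst (λ z → z ! ∣ₙ p ℕ.^ m ℕ.* m !) (sym (ℕ.m≡m%n+[m/n]*n n p)) (n!∣p^m*m! m (ℕ.m%n<n n p)))
          (∣𝒞-*ˡ (w ^ r) (∣𝒞-resp (^-congˡ m (≈-sym w^p)) (∣𝒞-binomial (p ℕ.^ m) m outer))))
        where
        m = n ℕ./ p
        r = n ℕ.% p
        m<n : m < n
        m<n = ℕ.m/n<m n p 1<p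
        inner : ∀ {j} → j ≤ m → p ℕ.^ j ℕ.* j ! ∣𝒞 (B₁ + B₂) ^ j
        inner {j} j≤m = ∣𝒞-binomial (p ℕ.^ j) j λ a b a+b≡j →
          B₁B₂ a b a+b≡j (rec (ℕ.≤-<-trans (ℕ.m+n≤o⇒m≤o a (ℕ.≤-trans (ℕ.≤-reflexive a+b≡j) j≤m)) m<n))
        outer : ∀ i j → i ℕ.+ j ≡ m → p ℕ.^ m ℕ.* (i ! ℕ.* j !) ∣𝒞 ∇ ^ i * (B₁ + B₂) ^ j
        outer i j i+j≡m = subst (_∣𝒞 ∇ ^ i * (B₁ + B₂) ^ j) regroup
          (∣𝒞-∇ i (inner (ℕ.m+n≤o⇒n≤o i (ℕ.≤-reflexive i+j≡m))))
          where
          arrange : ∀ a b c d → a ℕ.* c ℕ.* (b ℕ.* d) ≡ a ℕ.* b ℕ.* (c ℕ.* d)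
          arrange = ℕSolver.solve-∀
          regroup : p ℕ.^ i ℕ.* i ! ℕ.* (p ℕ.^ j ℕ.* j !) ≡ p ℕ.^ m ℕ.* (i ! ℕ.* j !)
          regroup = trans (arrange (p ℕ.^ i) (p ℕ.^ j) (i !) (j !))
            (cong (ℕ._* (i ! ℕ.* j !)) (trans (sym (ℕ.^-distribˡ-+-* p i j)) (cong (p ℕ.^_) i+j≡m)))
        open ≈-Reasoning
        split : w ^ r * (w ^ p) ^ m ≈ₚ w ^ n
        split = begin
          w ^ r * (w ^ p) ^ m       ≈⟨ *-congˡ {w ^ r} (^-assocʳ w p m) ⟩
          w ^ r * w ^ (p ℕ.* m)     ≈⟨ ^-homo-* w r (p ℕ.* m) ⟨
          w ^ (r ℕ.+ p ℕ.* m)       ≡⟨ cong (λ z → w ^ (r ℕ.+ z)) (ℕ.*-comm p m) ⟩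
          w ^ (r ℕ.+ m ℕ.* p)       ≡⟨ cong (w ^_) (ℕ.m≡m%n+[m/n]*n n p) ⟨
          w ^ n                     ∎

-- The Frobenius congruence for powers of 1 - X

geometric : Poly → ℕ → Poly
geometric Y n = sum {n} (λ i → Y ^ toℕ i)

1-Y*geometric : ∀ Y n → (1# - Y) * geometric Y n ≈ₚ 1# - Y ^ n
1-Y*geometric Y zero    = solve 1 (λ y → (con 1ℤ :- y) :* con 0ℤ := con 1ℤ :- con 1ℤ) ≈-refl Y
1-Y*geometric Y (suc n) = begin
  (1# - Y) * (1# + sum {n} (λ i → Y * Y ^ toℕ i))
    ≈⟨ *-congˡ {1# - Y} (+-congˡ {1#} (*-distribˡ-sum Y (λ (i : Fin n) → Y ^ toℕ i))) ⟨
  (1# - Y) * (1# + Y * geometric Y n)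
    ≈⟨ solve 2 (λ y g → (con 1ℤ :- y) :* (con 1ℤ :+ y :* g) :=
                        (con 1ℤ :- y) :+ y :* ((con 1ℤ :- y) :* g)) ≈-refl Y (geometric Y n) ⟩
  (1# - Y) + Y * ((1# - Y) * geometric Y n)
    ≈⟨ +-congˡ {1# - Y} (*-congˡ {Y} (1-Y*geometric Y n)) ⟩
  (1# - Y) + Y * (1# - Y ^ n)
    ≈⟨ solve 2 (λ y z → (con 1ℤ :- y) :+ y :* (con 1ℤ :- z) := con 1ℤ :- y :* z) ≈-refl Y (Y ^ n) ⟩
  1# - Y ^ suc n ∎
  where open ≈-Reasoning

-- In the application `n`, `a`, `h` are p, 1 - Y, H, so `a + n * h` is w. Replacing `a` by w next to
-- `e` costs n² h e, which joins the other multiples of n².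
regroup : ∀ z n a e d k h →
  (z + n * (a * e)) + (n * (n * d) + n * (n * k)) ≈ₚ
  z + (n * ((a + n * h) * e) + n * (n * (k + d - h * e)))
regroup = solve 7 (λ z n a e d k h →
  (z :+ n :* (a :* e)) :+ (n :* (n :* d) :+ n :* (n :* k)) :=
  z :+ (n :* ((a :+ n :* h) :* e) :+ n :* (n :* (k :+ d :- h :* e)))) ≈-refl

module Frobenius (p′ : ℕ) (pp : Prime (suc p′)) where

  private
    p : ℕ
    p = suc p′

  open Local p pp

  p∣pC : ∀ {i} → i < p′ → p ℕ.∣ p C suc i
  p∣pC {i} i<p′ with euclidsLemma (suc i) (p C suc i) pp
                       (subst (p ℕ.∣_) (sym (C-absorb p′ i)) (ℕ.m∣m*n (p′ C i)))
  ... | inj₁ p∣1+i = contradiction (ℕ.∣⇒≤ p∣1+i) (ℕ.<⇒≱ (s≤s i<p′))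
  ... | inj₂ d     = d

  -- The coefficient of X^(i+1) in the operator g; the division is exact for `i < p′` by `p∣pC`.
  c : ℕ → ℕ
  c i = (p C suc i) ℕ./ p

  p*c : ∀ {i} → i < p′ → p ℕ.* c i ≡ p C suc i
  p*c i<p′ = ℕ.m*[n/m]≡n (p∣pC i<p′)

  -- By Pascal's rule C(p-1,i) + C(p-1,i+1) = C(p,i+1), a multiple of p, so consecutive values are
  -- opposite modulo p.
  p′C : ∀ i → i ≤ p′ → ∃[ a ] -1ℤ ℤ.^ i ℤ.* + (p′ C i) ≡ 1ℤ ℤ.+ + p ℤ.* a
  p′C zero    _     = 0ℤ , sym (cong (ℤ._+_ 1ℤ) (ℤ.*-zeroʳ (+ p)))
  p′C (suc i) i<p′ with p′C i (ℕ.<⇒≤ i<p′)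
  ... | a , eq = a ℤ.- -1ℤ ℤ.^ i ℤ.* + c i , (begin
    -1ℤ ℤ.* -1ℤ ℤ.^ i ℤ.* + (p′ C suc i)
      ≡⟨ tidy (-1ℤ ℤ.^ i) (+ (p′ C i)) (+ (p′ C suc i)) ⟩
    -1ℤ ℤ.^ i ℤ.* + (p′ C i) ℤ.- -1ℤ ℤ.^ i ℤ.* (+ (p′ C i) ℤ.+ + (p′ C suc i))
      ≡⟨ cong₂ (λ u v → u ℤ.- -1ℤ ℤ.^ i ℤ.* v) eq pascal ⟩
    1ℤ ℤ.+ + p ℤ.* a ℤ.- -1ℤ ℤ.^ i ℤ.* (+ p ℤ.* + c i)
      ≡⟨ collect (+ p) a (-1ℤ ℤ.^ i) (+ c i) ⟩
    1ℤ ℤ.+ + p ℤ.* (a ℤ.- -1ℤ ℤ.^ i ℤ.* + c i) ∎)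
    where
    open ≡-Reasoning
    tidy : ∀ e a b → -1ℤ ℤ.* e ℤ.* b ≡ e ℤ.* a ℤ.- e ℤ.* (a ℤ.+ b)
    tidy = solve-∀
    collect : ∀ p a e c → 1ℤ ℤ.+ p ℤ.* a ℤ.- e ℤ.* (p ℤ.* c) ≡ 1ℤ ℤ.+ p ℤ.* (a ℤ.- e ℤ.* c)
    collect = solve-∀
    pascal : + (p′ C i) ℤ.+ + (p′ C suc i) ≡ + p ℤ.* + c i
    pascal = trans (sym (ℤ.pos-+ (p′ C i) _)) (trans
      (cong +_ (trans (nCk+nC[k+1]≡[n+1]C[k+1] p′ i) (sym (p*c i<p′)))) (ℤ.pos-* p (c i)))

  neg-^ : ∀ Y i → (- Y) ^ i ≈ₚ const (-1ℤ ℤ.^ i) * Y ^ i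
  neg-^ Y zero    = ≈-sym (*-identityˡ 1#)
  neg-^ Y (suc i) = ≈-trans (*-congˡ { - Y } (neg-^ Y i)) (pointwise λ f k →
    at (solve 3 (λ y e z → (:- y) :* (e :* z) := (:- e) :* (y :* z)) ≈-refl Y (const (-1ℤ ℤ.^ i)) (Y ^ i)) f k
    ∙ sym (ℤ.*-assoc -1ℤ (-1ℤ ℤ.^ i) _))
    where _∙_ = trans

  1^ : ∀ n → 1# ^ n ≈ₚ 1#
  1^ zero    = ≈-refl
  1^ (suc n) = ≈-trans (*-identityˡ _) (1^ n)

  -- By `p′C` every coefficient of (1 - Y)^(p-1) is 1 modulo p.
  [1-Y]^p′ : ∀ Y → ∃[ E ] (1# - Y) ^ p′ ≈ₚ geometric Y p + nat p * E
  [1-Y]^p′ Y = sum {p} (λ i → const (err i) * Y ^ toℕ i) , (begin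
    (1# - Y) ^ p′
      ≈⟨ ^-congˡ p′ (solve 1 (λ y → con 1ℤ :- y := :- y :+ con 1ℤ) ≈-refl Y) ⟩
    (- Y + 1#) ^ p′
      ≈⟨ Binomial.theorem commutativeSemiring p′ (- Y) 1# ⟩
    sum {p} (λ i → (p′ C toℕ i) · ((- Y) ^ toℕ i * 1# ^ (p′ ℕ.∸ toℕ i)))
      ≈⟨ sum-cong-≋ {p} term ⟩
    sum {p} (λ i → Y ^ toℕ i + nat p * (const (err i) * Y ^ toℕ i))
      ≈⟨ ∑-distrib-+ (λ (i : Fin p) → Y ^ toℕ i) (λ i → nat p * (const (err i) * Y ^ toℕ i)) ⟩
    geometric Y p + sum {p} (λ i → nat p * (const (err i) * Y ^ toℕ i))
      ≈⟨ +-congˡ {geometric Y p} (*-distribˡ-sum (nat p) (λ (i : Fin p) → const (err i) * Y ^ toℕ i)) ⟨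
    geometric Y p + nat p * sum {p} (λ i → const (err i) * Y ^ toℕ i) ∎)
    where
    open ≈-Reasoning
    err : Fin p → ℤ
    err i = proj₁ (p′C (toℕ i) (ℕ.s≤s⁻¹ (toℕ<n i)))
    term : ∀ i → (p′ C toℕ i) · ((- Y) ^ toℕ i * 1# ^ (p′ ℕ.∸ toℕ i)) ≈ₚ
                 Y ^ toℕ i + nat p * (const (err i) * Y ^ toℕ i)
    term i = begin
      (p′ C toℕ i) · ((- Y) ^ toℕ i * 1# ^ (p′ ℕ.∸ toℕ i))
        ≈⟨ pointwise (·-act (p′ C toℕ i) _) ⟩
      nat (p′ C toℕ i) * ((- Y) ^ toℕ i * 1# ^ (p′ ℕ.∸ toℕ i))
        ≈⟨ *-congˡ {nat (p′ C toℕ i)} (*-cong (neg-^ Y (toℕ i)) (1^ (p′ ℕ.∸ toℕ i))) ⟩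
      nat (p′ C toℕ i) * (const (-1ℤ ℤ.^ toℕ i) * Y ^ toℕ i * 1#)
        ≈⟨ solve 3 (λ a e z → a :* (e :* z :* con 1ℤ) := (e :* a) :* z) ≈-refl
             (nat (p′ C toℕ i)) (const (-1ℤ ℤ.^ toℕ i)) (Y ^ toℕ i) ⟩
      const (-1ℤ ℤ.^ toℕ i) * nat (p′ C toℕ i) * Y ^ toℕ i
        ≈⟨ *-congʳ {Y ^ toℕ i} (pointwise λ f k → coefficient (f k)) ⟩
      (1# + nat p * const (err i)) * Y ^ toℕ i
        ≈⟨ solve 3 (λ p e z → (con 1ℤ :+ p :* e) :* z := z :+ p :* (e :* z)) ≈-refl
             (nat p) (const (err i)) (Y ^ toℕ i) ⟩
      Y ^ toℕ i + nat p * (const (err i) * Y ^ toℕ i) ∎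
      where
      assoc-distrib : ∀ p a x → (1ℤ ℤ.+ p ℤ.* a) ℤ.* x ≡ 1ℤ ℤ.* x ℤ.+ p ℤ.* (a ℤ.* x)
      assoc-distrib = solve-∀
      coefficient : ∀ x → -1ℤ ℤ.^ toℕ i ℤ.* (+ (p′ C toℕ i) ℤ.* x) ≡ 1ℤ ℤ.* x ℤ.+ + p ℤ.* (err i ℤ.* x)
      coefficient x = trans (sym (ℤ.*-assoc (-1ℤ ℤ.^ toℕ i) _ x)) (trans
        (cong (ℤ._* x) (proj₂ (p′C (toℕ i) (ℕ.s≤s⁻¹ (toℕ<n i))))) (assoc-distrib (+ p) (err i) x))

  -- Multiplying the congruence for exponent p - 1 by 1 - Y telescopes the geometric sum and leaves
  -- a factor 1 - Y in the error term, which the induction on powers of w depends on.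
  [1-Y]^p : ∀ Y → ∃[ E ] (1# - Y) ^ p ≈ₚ (1# - Y ^ p) + nat p * ((1# - Y) * E)
  [1-Y]^p Y = proj₁ ([1-Y]^p′ Y) , multiply (proj₂ ([1-Y]^p′ Y)) (1-Y*geometric Y p)
    where
    multiply : ∀ {A P G E N Z} → P ≈ₚ G + N * E → A * G ≈ₚ Z → A * P ≈ₚ Z + N * (A * E)
    multiply {A} {P} {G} {E} {N} {Z} eq eq′ = ≈-trans (*-congˡ {A} eq) (≈-trans
      (solve 4 (λ a g n e → a :* (g :+ n :* e) := a :* g :+ n :* (a :* e)) ≈-refl A G N E)
      (+-congʳ {N * (A * E)} eq′))

  -- The expansion to first order in p. For exponent p the linear coefficient is another p, so only
  -- multiples of p² are added to A^p.
  [A+pB]^n : ∀ A B n → ∃[ K ] (A + nat p * B) ^ suc n ≈ₚ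
             A ^ suc n + (nat (suc n) * (nat p * (A ^ n * B)) + nat p * (nat p * K))
  [A+pB]^n A B zero    = 0# , solve 3 (λ a b n → (a :+ n :* b) :* con 1ℤ :=
    a :* con 1ℤ :+ (con 1ℤ :* (n :* (con 1ℤ :* b)) :+ n :* (n :* con 0ℤ))) ≈-refl A B (nat p)
  [A+pB]^n A B (suc n) with [A+pB]^n A B n
  ... | K , eq = A * K + nat (suc n) * (A ^ n * B * B) + nat p * (B * K) , (begin
    (A + nat p * B) * (A + nat p * B) ^ suc n
      ≈⟨ *-congˡ {A + nat p * B} eq ⟩
    (A + nat p * B) * (A ^ suc n + (nat (suc n) * (nat p * (A ^ n * B)) + nat p * (nat p * K)))
      ≈⟨ solve 6 (λ a b z m n k →
           (a :+ n :* b) :* (a :* z :+ (m :* (n :* (z :* b)) :+ n :* (n :* k))) :=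
           a :* (a :* z) :+ ((con 1ℤ :+ m) :* (n :* ((a :* z) :* b)) :+
             n :* (n :* (a :* k :+ m :* (z :* b :* b) :+ n :* (b :* k)))))
           ≈-refl A B (A ^ n) (nat (suc n)) (nat p) K ⟩
    A ^ suc (suc n) + ((1# + nat (suc n)) * (nat p * (A ^ suc n * B)) + nat p * (nat p * _))
      ≈⟨ +-congˡ {A ^ suc (suc n)} (+-congʳ (*-congʳ {nat p * (A ^ suc n * B)}
           (pointwise λ f k → sym (ℤ.*-distribʳ-+ (f k) 1ℤ (+ suc n))))) ⟩
    A ^ suc (suc n) + (nat (suc (suc n)) * (nat p * (A ^ suc n * B)) + nat p * (nat p * _)) ∎)
    where open ≈-Reasoning

  -- The factor 1 - Y in [1-Y]^p becomes a factor w here, at the cost of a multiple of p².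
  w^p : ∀ {w Y H} → w ≈ₚ (1# - Y) + nat p * H →
        ∃[ E ] ∃[ K ] w ^ p ≈ₚ (1# - Y ^ p) + (nat p * (w * E) + nat p * (nat p * K))
  w^p {w} {Y} {H} eq = E , K + D - H * E ,
    ≈-trans (^-congˡ p eq) (≈-trans (proj₂ ([A+pB]^n (1# - Y) H p′)) (≈-trans
      (+-congʳ {nat p * (nat p * D) + nat p * (nat p * K)} (proj₂ ([1-Y]^p Y)))
      (≈-trans (regroup (1# - Y ^ p) (nat p) (1# - Y) E D K H)
        (+-congˡ {1# - Y ^ p} (+-congʳ {nat p * (nat p * (K + D - H * E))}
          (*-congˡ {nat p} (*-congʳ {E} (≈-sym eq))))))))
    where
    E D K : Poly
    E = proj₁ ([1-Y]^p Y)
    D = (1# - Y) ^ p′ * H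
    K = proj₁ ([A+pB]^n (1# - Y) H p′)

  -- Each step raises to the p-th power by `w^p` with Y = X^(p^β); its two error terms are merged
  -- into one multiple of p.
  [1-X]^[p^β] : ∀ β → ∃[ H ] (1# - X) ^ (p ℕ.^ β) ≈ₚ (1# - X ^ (p ℕ.^ β)) + nat p * H
  [1-X]^[p^β] zero = 0# , solve 2 (λ x n → (con 1ℤ :- x) :* con 1ℤ :=
    (con 1ℤ :- x :* con 1ℤ) :+ n :* con 0ℤ) ≈-refl X (nat p)
  [1-X]^[p^β] (suc β) = w * E + nat p * K , (begin
    (1# - X) ^ (p ℕ.* q)
    ≡⟨ cong ((1# - X) ^_) (ℕ.*-comm p q) ⟩
    (1# - X) ^ (q ℕ.* p)
      ≈⟨ ^-assocʳ (1# - X) q p ⟨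
    w ^ p
      ≈⟨ proj₂ (proj₂ step) ⟩
    (1# - (X ^ q) ^ p) + (nat p * (w * E) + nat p * (nat p * K))
      ≈⟨ solve 4 (λ z n a k → (con 1ℤ :- z) :+ (n :* a :+ n :* (n :* k)) :=
           (con 1ℤ :- z) :+ n :* (a :+ n :* k)) ≈-refl ((X ^ q) ^ p) (nat p) (w * E) K ⟩
    (1# - (X ^ q) ^ p) + nat p * (w * E + nat p * K)
      ≈⟨ +-congʳ (+-congˡ {1#} (*-congˡ {const -1ℤ} (^-assocʳ X q p))) ⟩
    (1# - X ^ (q ℕ.* p)) + nat p * (w * E + nat p * K)
      ≡⟨ cong (λ z → (1# - X ^ z) + nat p * (w * E + nat p * K)) (ℕ.*-comm q p) ⟩
    (1# - X ^ (p ℕ.* q)) + nat p * (w * E + nat p * K) ∎)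
    where
    open ≈-Reasoning
    q = p ℕ.^ β
    w = (1# - X) ^ q
    step = w^p (proj₂ ([1-X]^[p^β] β))
    E = proj₁ step
    K = proj₁ (proj₂ step)

-- The expansion of (1 + X)^(p n)

-- Indexed by natural numbers instead of `Fin`, so that ranges can be split and reindexed by plain
-- arithmetic.
∑ : ℕ → (ℕ → ℤ) → ℤ
∑ zero    h = 0ℤ
∑ (suc n) h = h 0 ℤ.+ ∑ n (h ∘ suc)

∑-cong : ∀ n {g h} → (∀ i → i < n → g i ≡ h i) → ∑ n g ≡ ∑ n h
∑-cong zero    eq = refl
∑-cong (suc n) eq = cong₂ ℤ._+_ (eq 0 (s≤s z≤n)) (∑-cong n λ i i<n → eq (suc i) (s≤s i<n))

∑-zero : ∀ n {h} → (∀ i → i < n → h i ≡ 0ℤ) → ∑ n h ≡ 0ℤ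
∑-zero zero    eq = refl
∑-zero (suc n) eq = cong₂ ℤ._+_ (eq 0 (s≤s z≤n)) (∑-zero n λ i i<n → eq (suc i) (s≤s i<n))

∑-++ : ∀ m n h → ∑ (m ℕ.+ n) h ≡ ∑ m h ℤ.+ ∑ n (λ i → h (m ℕ.+ i))
∑-++ zero    n h = sym (ℤ.+-identityˡ _)
∑-++ (suc m) n h = trans (cong (ℤ._+_ (h 0)) (∑-++ m n (h ∘ suc))) (sym (ℤ.+-assoc (h 0) _ _))

∑-*ʳ : ∀ n h c → ∑ n (λ i → h i ℤ.* c) ≡ ∑ n h ℤ.* c
∑-*ʳ zero    h c = refl
∑-*ʳ (suc n) h c = trans (cong (ℤ._+_ (h 0 ℤ.* c)) (∑-*ʳ n (h ∘ suc) c)) (sym (ℤ.*-distribʳ-+ c (h 0) _))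

∑-+ : ∀ n g h → ∑ n (λ i → g i ℤ.+ h i) ≡ ∑ n g ℤ.+ ∑ n h
∑-+ zero    g h = refl
∑-+ (suc n) g h = trans (cong (ℤ._+_ (g 0 ℤ.+ h 0)) (∑-+ n (g ∘ suc) (h ∘ suc)))
  (interchange (g 0) (h 0) _ _)
  where
  interchange : ∀ a b c d → a ℤ.+ b ℤ.+ (c ℤ.+ d) ≡ a ℤ.+ c ℤ.+ (b ℤ.+ d)
  interchange = solve-∀

∑-single : ∀ n {j h} → j < n → (∀ i → i < n → i ≢ j → h i ≡ 0ℤ) → ∑ n h ≡ h j
∑-single (suc n) {zero} {h} _ eq = trans
  (cong (ℤ._+_ (h 0)) (∑-zero n λ i i<n → eq (suc i) (s≤s i<n) λ ())) (ℤ.+-identityʳ (h 0))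
∑-single (suc n) {suc j} {h} (s≤s j<n) eq = trans
  (cong₂ ℤ._+_ (eq 0 (s≤s z≤n) λ ()) (∑-single n j<n λ i i<n i≢j → eq (suc i) (s≤s i<n) (i≢j ∘ ℕ.suc-injective)))
  (ℤ.+-identityˡ _)

-- The range is cut into blocks of length m + 1, each contributing only its first entry; the extra
-- `suc` keeps the last multiple.
∑-multiples : ∀ m n {h} → (∀ i → ¬ suc m ℕ.∣ i → h i ≡ 0ℤ) →
              ∑ (suc (n ℕ.* suc m)) h ≡ ∑ (suc n) (λ k → h (k ℕ.* suc m))
∑-multiples m zero    eq = refl
∑-multiples m (suc n) {h} eq = begin
  ∑ (suc (suc m ℕ.+ n ℕ.* suc m)) h
    ≡⟨ cong (λ z → ∑ z h) (ℕ.+-suc (suc m) (n ℕ.* suc m)) ⟨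
  ∑ (suc m ℕ.+ suc (n ℕ.* suc m)) h
    ≡⟨ ∑-++ (suc m) _ h ⟩
  ∑ (suc m) h ℤ.+ ∑ (suc (n ℕ.* suc m)) (λ i → h (suc m ℕ.+ i))
    ≡⟨ cong₂ ℤ._+_ first (∑-multiples m n λ i m∤i → eq _ (m∤i ∘ λ d → ℕ.∣m+n∣m⇒∣n d ℕ.∣-refl)) ⟩
  h 0 ℤ.+ ∑ (suc n) (λ k → h (suc k ℕ.* suc m)) ∎
  where
  open ≡-Reasoning
  first : ∑ (suc m) h ≡ h 0
  first = ∑-single (suc m) {0} {h} (s≤s z≤n) λ where
    zero    _   0≢0 → contradiction refl 0≢0
    (suc i) i<m _   → eq (suc i) (ℕ.>⇒∤ i<m)

sum-act : ∀ n (w : ℕ → Poly) f k → ⟦ sum {n} (w ∘ toℕ) ⟧ f k ≡ ∑ n (λ i → ⟦ w i ⟧ f k)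
sum-act zero    w f k = refl
sum-act (suc n) w f k = cong (ℤ._+_ (⟦ w 0 ⟧ f k)) (sum-act n (w ∘ suc) f k)

sum-last : ∀ n (w : ℕ → Poly) → sum {suc n} (w ∘ toℕ) ≈ₚ sum {n} (w ∘ toℕ) + w n
sum-last zero    w = solve 1 (λ a → a :+ con 0ℤ := con 0ℤ :+ a) ≈-refl (w 0)
sum-last (suc n) w = ≈-trans (+-congˡ {w 0} (sum-last n (w ∘ suc)))
  (solve 3 (λ a b c → a :+ (b :+ c) := (a :+ b) :+ c) ≈-refl (w 0) (sum {n} (w ∘ suc ∘ toℕ)) (w (suc n)))

1^-act : ∀ n f k → ⟦ 1# ^ n ⟧ f k ≡ f k
1^-act zero    f k = ℤ.*-identityˡ (f k)
1^-act (suc n) f k = trans (ℤ.*-identityˡ _) (1^-act n f k)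

X+1^-act : ∀ n f k → ⟦ (X + 1#) ^ n ⟧ f k ≡ ∑ (suc n) (λ i → + (n C i) ℤ.* f (i ℕ.+ k))
X+1^-act n f k = begin
  ⟦ (X + 1#) ^ n ⟧ f k
    ≡⟨ at (Binomial.theorem commutativeSemiring n X 1#) f k ⟩
  ⟦ sum {suc n} (w ∘ toℕ) ⟧ f k
    ≡⟨ sum-act (suc n) w f k ⟩
  ∑ (suc n) (λ i → ⟦ w i ⟧ f k)
    ≡⟨ ∑-cong (suc n) (λ i _ → trans (·-act (n C i) (X ^ i * 1# ^ (n ℕ.∸ i)) f k) (cong (ℤ._*_ (+ (n C i)))
         (trans (X^-act i (⟦ 1# ^ (n ℕ.∸ i) ⟧ f) k) (1^-act (n ℕ.∸ i) f (i ℕ.+ k))))) ⟩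
  ∑ (suc n) (λ i → + (n C i) ℤ.* f (i ℕ.+ k)) ∎
  where
  open ≡-Reasoning
  w : ℕ → Poly
  w i = (n C i) · (X ^ i * 1# ^ (n ℕ.∸ i))

-- X ^ m acts on U m f as - X acts on f.
U : ℕ → (ℕ → ℤ) → ℕ → ℤ
U m f i with m ℕ.∣? i
... | yes (ℕ.divides k _) = -1ℤ ℤ.^ k ℤ.* f k
... | no  _               = 0ℤ

module _ (m : ℕ) .{{_ : NonZero m}} where

  U-multiple : ∀ f k → U m f (k ℕ.* m) ≡ -1ℤ ℤ.^ k ℤ.* f k
  U-multiple f k with m ℕ.∣? (k ℕ.* m)
  ... | yes (ℕ.divides l eq) = cong (λ z → -1ℤ ℤ.^ z ℤ.* f z) (sym (ℕ.*-cancelʳ-≡ k l m eq))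
  ... | no  m∤km             = contradiction (ℕ.n∣m*n k) m∤km

  U-∤ : ∀ f {i} → ¬ m ℕ.∣ i → U m f i ≡ 0ℤ
  U-∤ f {i} m∤i with m ℕ.∣? i
  ... | yes m∣i = contradiction m∣i m∤i
  ... | no  _   = refl

  U-cong : ∀ {f g} → f ≗ g → U m f ≗ U m g
  U-cong f≗g i with m ℕ.∣? i
  ... | yes (ℕ.divides k _) = cong (ℤ._*_ (-1ℤ ℤ.^ k)) (f≗g k)
  ... | no  _               = refl

  X^m+1-U : ∀ f i → ⟦ X ^ m + 1# ⟧ (U m f) i ≡ U m (⟦ 1# - X ⟧ f) i
  X^m+1-U f i = trans (cong (ℤ._+ 1ℤ ℤ.* U m f i) (X^-act m (U m f) i)) (cases (m ℕ.∣? i))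
    where
    tidy : ∀ e a b → -1ℤ ℤ.* e ℤ.* b ℤ.+ 1ℤ ℤ.* (e ℤ.* a) ≡ e ℤ.* (1ℤ ℤ.* a ℤ.+ -1ℤ ℤ.* b)
    tidy = solve-∀
    cases : Dec (m ℕ.∣ i) → U m f (m ℕ.+ i) ℤ.+ 1ℤ ℤ.* U m f i ≡ U m (⟦ 1# - X ⟧ f) i
    cases (yes (ℕ.divides k refl)) = trans
      (cong₂ (λ a b → a ℤ.+ 1ℤ ℤ.* b) (U-multiple f (suc k)) (U-multiple f k))
      (trans (tidy (-1ℤ ℤ.^ k) (f k) (f (suc k))) (sym (U-multiple (⟦ 1# - X ⟧ f) k)))
    cases (no m∤i) = trans
      (cong₂ (λ a b → a ℤ.+ 1ℤ ℤ.* b) (U-∤ f λ d → m∤i (ℕ.∣m+n∣m⇒∣n d ℕ.∣-refl)) (U-∤ f m∤i))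
      (sym (U-∤ (⟦ 1# - X ⟧ f) m∤i))

  [X^m+1]^-U : ∀ n f i → ⟦ (X ^ m + 1#) ^ n ⟧ (U m f) i ≡ U m (⟦ (1# - X) ^ n ⟧ f) i
  [X^m+1]^-U zero    f i = trans (ℤ.*-identityˡ _) (U-cong (λ k → sym (ℤ.*-identityˡ (f k))) i)
  [X^m+1]^-U (suc n) f i =
    trans (⟦⟧-cong (X ^ m + 1#) ([X^m+1]^-U n f) i) (X^m+1-U (⟦ (1# - X) ^ n ⟧ f) i)

U-expand : ∀ m .{{_ : NonZero m}} n f →
           ⟦ (X + 1#) ^ (m ℕ.* n) ⟧ (U m f) 0 ≡
           ∑ (suc n) (λ k → + ((m ℕ.* n) C (m ℕ.* k)) ℤ.* (-1ℤ ℤ.^ k ℤ.* f k))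
U-expand m@(suc m′) n f = begin
  ⟦ (X + 1#) ^ (m ℕ.* n) ⟧ (U m f) 0
    ≡⟨ X+1^-act (m ℕ.* n) (U m f) 0 ⟩
  ∑ (suc (m ℕ.* n)) h
    ≡⟨ cong (λ z → ∑ (suc z) h) (ℕ.*-comm m n) ⟩
  ∑ (suc (n ℕ.* m)) h
    ≡⟨ ∑-multiples m′ n (λ i m∤i → trans (cong (λ z → + ((m ℕ.* n) C i) ℤ.* U m f z) (ℕ.+-identityʳ i))
         (trans (cong (ℤ._*_ (+ ((m ℕ.* n) C i))) (U-∤ m f m∤i)) (ℤ.*-zeroʳ (+ ((m ℕ.* n) C i))))) ⟩
  ∑ (suc n) (λ k → h (k ℕ.* m))
    ≡⟨ ∑-cong (suc n) (λ k _ → cong₂ (λ a b → + ((m ℕ.* n) C a) ℤ.* b) (ℕ.*-comm k m)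
         (trans (cong (U m f) (ℕ.+-identityʳ (k ℕ.* m))) (U-multiple m f k))) ⟩
  ∑ (suc n) (λ k → + ((m ℕ.* n) C (m ℕ.* k)) ℤ.* (-1ℤ ℤ.^ k ℤ.* f k)) ∎
  where
  open ≡-Reasoning
  h : ℕ → ℤ
  h i = + ((m ℕ.* n) C i) ℤ.* U m f (i ℕ.+ 0)

-- A difference of order m + 1 kills a polynomial of degree m, by `leibniz` with `y` the identity
-- and step 1. The exponent in `X ^ 1` matches the form of `leibniz`.
[1-X]^-monomial : ∀ m k → ⟦ (1# - X ^ 1) ^ suc m ⟧ (λ i → (+ i) ℤ.^ m) k ≡ 0ℤ
[1-X]^-monomial zero    k = 1-X^-act 1 (⟦ 1# ⟧ (λ _ → 1ℤ)) k
[1-X]^-monomial (suc m) k = trans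
  (leibniz 1 1ℤ (λ i → + i) (λ i → trans (cong (λ z → + z) (ℕ.+-comm 1 i)) (ℤ.pos-+ i 1)) (λ i → (+ i) ℤ.^ m) (suc m) k)
  (trans (cong₂ (λ a b → + k ℤ.* a ℤ.- + suc (suc m) ℤ.* 1ℤ ℤ.* b)
           (⟦⟧-zero (1# - X ^ 1) ([1-X]^-monomial m) k) ([1-X]^-monomial m (suc k)))
    (tidy (+ k) (+ suc (suc m))))
  where
  tidy : ∀ a b → a ℤ.* 0ℤ ℤ.- b ℤ.* 1ℤ ℤ.* 0ℤ ≡ 0ℤ
  tidy = solve-∀

-- The operator g, Fermat's theorem and Wolstenholme's congruence

module Congruence (p′ : ℕ) (pp : Prime (suc p′)) where

  private
    p : ℕ
    p = suc p′

  open Local p pp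
  open Frobenius p′ pp

  p∤< : ∀ {i} → i < p′ → ¬ p ℕ.∣ suc i
  p∤< i<p′ = ℕ.>⇒∤ (s≤s i<p′)

  g : Poly
  g = sum {p′} (λ i → nat (c (toℕ i)) * X ^ suc (toℕ i))

  g-act : ∀ f k → ⟦ g ⟧ f k ≡ ∑ p′ (λ i → + c i ℤ.* f (suc i ℕ.+ k))
  g-act f k = trans (sum-act p′ (λ i → nat (c i) * X ^ suc i) f k)
    (∑-cong p′ λ i _ → cong (ℤ._*_ (+ c i)) (X^-act (suc i) f k))

  X+1^p : (X + 1#) ^ p ≈ₚ nat p * g + (X ^ p + 1#)
  X+1^p = begin
    (X + 1#) ^ p
      ≈⟨ Binomial.theorem commutativeSemiring p X 1# ⟩
    t 0 + sum {suc p′} (t ∘ suc ∘ toℕ)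
      ≈⟨ +-congˡ {t 0} (sum-last p′ (t ∘ suc)) ⟩
    t 0 + (sum {p′} (t ∘ suc ∘ toℕ) + t p)
      ≈⟨ +-cong t0 (+-cong (≈-trans (sum-cong-≋ {p′} middle) (≈-sym
           (*-distribˡ-sum (nat p) (λ (i : Fin p′) → nat (c (toℕ i)) * X ^ suc (toℕ i))))) tp) ⟩
    1# + (nat p * g + X ^ p)
      ≈⟨ solve 2 (λ a b → con 1ℤ :+ (a :+ b) := a :+ (b :+ con 1ℤ)) ≈-refl (nat p * g) (X ^ p) ⟩
    nat p * g + (X ^ p + 1#) ∎
    where
    open ≈-Reasoning
    t : ℕ → Poly
    t i = (p C i) · (X ^ i * 1# ^ (p ℕ.∸ i))
    t≈ : ∀ i → t i ≈ₚ nat (p C i) * X ^ i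
    t≈ i = pointwise λ f k → trans (·-act (p C i) _ f k) (cong (ℤ._*_ (+ (p C i)))
      (⟦⟧-cong (X ^ i) (1^-act (p ℕ.∸ i) f) k))
    t0 : t 0 ≈ₚ 1#
    t0 = ≈-trans (t≈ 0) (*-identityˡ 1#)
    tp : t p ≈ₚ X ^ p
    tp = ≈-trans (t≈ p) (≈-trans (≈-reflexive (cong (λ z → nat z * X ^ p) (nCn≡1 p))) (*-identityˡ _))
    middle : ∀ (i : Fin p′) → t (suc (toℕ i)) ≈ₚ nat p * (nat (c (toℕ i)) * X ^ suc (toℕ i))
    middle i = begin
      t (suc (toℕ i))
        ≈⟨ t≈ (suc (toℕ i)) ⟩
      nat (p C suc (toℕ i)) * X ^ suc (toℕ i)
        ≡⟨ cong (λ z → nat z * X ^ suc (toℕ i)) (p*c (toℕ<n i)) ⟨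
      nat (p ℕ.* c (toℕ i)) * X ^ suc (toℕ i)
        ≈⟨ ≈-trans (*-congʳ (nat-* p (c (toℕ i)))) (*-assoc (nat p) (nat (c (toℕ i))) _) ⟩
      nat p * (nat (c (toℕ i)) * X ^ suc (toℕ i)) ∎

  infix 4 _≡ₚ_
  _≡ₚ_ : ℤ → ℤ → Set
  a ≡ₚ b = + p ∣ₚ a ℤ.- b

  -- On the sequence of powers of `a` the shift is multiplication by `a`. Applying an operator
  -- identity to it thus evaluates polynomials at `a`.
  X+1-pow : ∀ a n k → ⟦ (X + 1#) ^ n ⟧ (ℤ._^_ (+ a)) k ≡ (+ suc a) ℤ.^ n ℤ.* ((+ a) ℤ.^ k)
  X+1-pow a zero    k = refl
  X+1-pow a (suc n) k = trans (cong₂ (λ u v → u ℤ.+ 1ℤ ℤ.* v) (X+1-pow a n (suc k)) (X+1-pow a n k))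
    (tidy (+ a) ((+ suc a) ℤ.^ n) ((+ a) ℤ.^ k))
    where
    tidy : ∀ a b c → b ℤ.* (a ℤ.* c) ℤ.+ 1ℤ ℤ.* (b ℤ.* c) ≡ (1ℤ ℤ.+ a) ℤ.* b ℤ.* c
    tidy = solve-∀

  -- Evaluating `X+1^p` at `a` gives (a+1)^p = p G + a^p + 1, whence an induction on `a`.
  a^p≡a : ∀ a → (+ a) ℤ.^ p ≡ₚ + a
  a^p≡a zero    = ∣⇒∣ₚ (divides 0ℤ refl)
  a^p≡a (suc a) = subst (+ p ∣ₚ_) (sym rewritten) (∣ₚ-+ (∣⇒∣ₚ (ℤ∣.∣m⇒∣m*n G ℤ∣.∣-refl)) (a^p≡a a))
    where
    open ≡-Reasoning
    G = ⟦ g ⟧ (ℤ._^_ (+ a)) 0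
    tidy : ∀ P G z a → P ℤ.* G ℤ.+ (z ℤ.+ 1ℤ) ℤ.- (1ℤ ℤ.+ a) ≡ P ℤ.* G ℤ.+ (z ℤ.- a)
    tidy = solve-∀
    rewritten : (+ suc a) ℤ.^ p ℤ.- + suc a ≡ + p ℤ.* G ℤ.+ ((+ a) ℤ.^ p ℤ.- + a)
    rewritten = begin
      (+ suc a) ℤ.^ p ℤ.- + suc a
        ≡⟨ cong (ℤ._- + suc a) (ℤ.*-identityʳ ((+ suc a) ℤ.^ p)) ⟨
      (+ suc a) ℤ.^ p ℤ.* 1ℤ ℤ.- + suc a
        ≡⟨ cong (ℤ._- + suc a) (X+1-pow a p 0) ⟨
      ⟦ (X + 1#) ^ p ⟧ (ℤ._^_ (+ a)) 0 ℤ.- + suc a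
        ≡⟨ cong (ℤ._- + suc a) (at X+1^p (ℤ._^_ (+ a)) 0) ⟩
      + p ℤ.* G ℤ.+ (⟦ X ^ p ⟧ (ℤ._^_ (+ a)) 0 ℤ.+ 1ℤ) ℤ.- + suc a
        ≡⟨ cong (λ z → + p ℤ.* G ℤ.+ (z ℤ.+ 1ℤ) ℤ.- + suc a)
             (trans (X^-act p (ℤ._^_ (+ a)) 0) (cong (ℤ._^_ (+ a)) (ℕ.+-identityʳ p))) ⟩
      + p ℤ.* G ℤ.+ ((+ a) ℤ.^ p ℤ.+ 1ℤ) ℤ.- + suc a
        ≡⟨ tidy (+ p) G ((+ a) ℤ.^ p) (+ a) ⟩
      + p ℤ.* G ℤ.+ ((+ a) ℤ.^ p ℤ.- + a) ∎

  fermat : ∀ {a} → ¬ p ℕ.∣ a → (+ a) ℤ.^ p′ ≡ₚ 1ℤ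
  fermat {a} p∤a = ∣ₚ-dropˡ p∤a (subst (+ p ∣ₚ_) (factor (+ a) ((+ a) ℤ.^ p′)) (a^p≡a a))
    where
    factor : ∀ a b → a ℤ.* b ℤ.- a ≡ a ℤ.* (b ℤ.- 1ℤ)
    factor = solve-∀

  c-symm : ∀ {i} → i < p′ → c (p′ ℕ.∸ suc i) ≡ c i
  c-symm {i} i<p′ = cong (ℕ._/ p) (trans (cong (p C_) (sym (ℕ.+-∸-assoc 1 i<p′)))
    (sym (nCk≡nC[n∸k] (s≤s (ℕ.<⇒≤ i<p′)))))

  sign² : ∀ i → -1ℤ ℤ.^ i ℤ.* -1ℤ ℤ.^ i ≡ 1ℤ
  sign² zero    = refl
  sign² (suc i) = trans (tidy (-1ℤ ℤ.^ i)) (sign² i)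
    where
    tidy : ∀ e → -1ℤ ℤ.* e ℤ.* (-1ℤ ℤ.* e) ≡ e ℤ.* e
    tidy = solve-∀

  [1+i]*c : ∀ {i} → i < p′ → suc i ℕ.* c i ≡ p′ C i
  [1+i]*c {i} i<p′ = ℕ.*-cancelˡ-≡ _ _ p (trans (arrange p (suc i) (c i))
    (trans (cong (suc i ℕ.*_) (p*c i<p′)) (C-absorb p′ i)))
    where
    arrange : ∀ a b c → a ℕ.* (b ℕ.* c) ≡ b ℕ.* (a ℕ.* c)
    arrange = ℕSolver.solve-∀

  -- The hypothesis says p = m + 3, so `m` is the exponent p - 3 without truncated subtraction.
  module _ (m : ℕ) (p′≡ : p′ ≡ suc (suc m)) where

    -- Modulo p, c i ≡ (-1)^i / (i+1) and, by Fermat, 1 / (i+1)² ≡ (i+1)^m.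
    c²≡ : ∀ {i} → i < p′ → + c i ℤ.* + c i ≡ₚ (+ suc i) ℤ.^ m
    c²≡ {i} i<p′ = ∣ₚ-dropˡ (p∤< i<p′) (∣ₚ-dropˡ (p∤< i<p′) (subst (+ p ∣ₚ_) (sym expand)
      (∣ₚ-+ (∣⇒∣ₚ (ℤ∣.∣m⇒∣m*n (a ℤ.+ a ℤ.+ + p ℤ.* (a ℤ.* a)) ℤ∣.∣-refl)) (∣ₚ-*ˡ -1ℤ (fermat (p∤< i<p′))))))
      where
      open ≡-Reasoning
      a = proj₁ (p′C i (ℕ.<⇒≤ i<p′))
      eq = proj₂ (p′C i (ℕ.<⇒≤ i<p′))
      b = + suc i
      C′ = + (p′ C i)
      ε = -1ℤ ℤ.^ i
      tidy₁ : ∀ b c z → b ℤ.* (b ℤ.* (c ℤ.* c ℤ.- z)) ≡ 1ℤ ℤ.* ((b ℤ.* c) ℤ.* (b ℤ.* c)) ℤ.- b ℤ.* (b ℤ.* z)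
      tidy₁ = solve-∀
      tidy₂ : ∀ e c → (e ℤ.* e) ℤ.* (c ℤ.* c) ≡ (e ℤ.* c) ℤ.* (e ℤ.* c)
      tidy₂ = solve-∀
      tidy₃ : ∀ p a z → (1ℤ ℤ.+ p ℤ.* a) ℤ.* (1ℤ ℤ.+ p ℤ.* a) ℤ.- z ≡
              p ℤ.* (a ℤ.+ a ℤ.+ p ℤ.* (a ℤ.* a)) ℤ.+ -1ℤ ℤ.* (z ℤ.- 1ℤ)
      tidy₃ = solve-∀
      expand : b ℤ.* (b ℤ.* (+ c i ℤ.* + c i ℤ.- b ℤ.^ m)) ≡
               + p ℤ.* (a ℤ.+ a ℤ.+ + p ℤ.* (a ℤ.* a)) ℤ.+ -1ℤ ℤ.* (b ℤ.^ p′ ℤ.- 1ℤ)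
      expand = begin
        b ℤ.* (b ℤ.* (+ c i ℤ.* + c i ℤ.- b ℤ.^ m))
          ≡⟨ tidy₁ b (+ c i) (b ℤ.^ m) ⟩
        1ℤ ℤ.* ((b ℤ.* + c i) ℤ.* (b ℤ.* + c i)) ℤ.- b ℤ.^ suc (suc m)
          ≡⟨ cong₂ (λ u v → 1ℤ ℤ.* (u ℤ.* u) ℤ.- b ℤ.^ v)
               (trans (sym (ℤ.pos-* (suc i) (c i))) (cong +_ ([1+i]*c i<p′))) (sym p′≡) ⟩
        1ℤ ℤ.* (C′ ℤ.* C′) ℤ.- b ℤ.^ p′
          ≡⟨ cong (λ u → u ℤ.* (C′ ℤ.* C′) ℤ.- b ℤ.^ p′) (sign² i) ⟨
        ε ℤ.* ε ℤ.* (C′ ℤ.* C′) ℤ.- b ℤ.^ p′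
          ≡⟨ cong (ℤ._- b ℤ.^ p′) (tidy₂ ε C′) ⟩
        (ε ℤ.* C′) ℤ.* (ε ℤ.* C′) ℤ.- b ℤ.^ p′
          ≡⟨ cong (λ u → u ℤ.* u ℤ.- b ℤ.^ p′) eq ⟩
        (1ℤ ℤ.+ + p ℤ.* a) ℤ.* (1ℤ ℤ.+ + p ℤ.* a) ℤ.- b ℤ.^ p′
          ≡⟨ tidy₃ (+ p) a (b ℤ.^ p′) ⟩
        + p ℤ.* (a ℤ.+ a ℤ.+ + p ℤ.* (a ℤ.* a)) ℤ.+ -1ℤ ℤ.* (b ℤ.^ p′ ℤ.- 1ℤ) ∎

    -- (1-X)^(p-1) ≡ 1 + X + ⋯ + X^(p-1) kills i^m modulo p because m < p - 1.
    ∑-pow : + p ∣ₚ ∑ p (λ i → (+ i) ℤ.^ m)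
    ∑-pow = subst (+ p ∣ₚ_) (sym value) (∣⇒∣ₚ (ℤ∣.∣m⇒∣m*n (-1ℤ ℤ.* ⟦ E ⟧ f 0) ℤ∣.∣-refl))
      where
      open ≡-Reasoning
      E = proj₁ ([1-Y]^p′ X)
      eq = proj₂ ([1-Y]^p′ X)
      f : ℕ → ℤ
      f i = (+ i) ℤ.^ m
      killed : ⟦ (1# - X) ^ p′ ⟧ f 0 ≡ 0ℤ
      killed = begin
        ⟦ (1# - X) ^ p′ ⟧ f 0
          ≡⟨ at (^-congˡ p′ (solve 1 (λ x → con 1ℤ :- x := con 1ℤ :- x :* con 1ℤ) ≈-refl X)) f 0 ⟩
        ⟦ (1# - X ^ 1) ^ p′ ⟧ f 0
          ≡⟨ cong (λ z → ⟦ (1# - X ^ 1) ^ z ⟧ f 0) p′≡ ⟩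
        ⟦ 1# - X ^ 1 ⟧ (⟦ (1# - X ^ 1) ^ suc m ⟧ f) 0
          ≡⟨ ⟦⟧-zero (1# - X ^ 1) ([1-X]^-monomial m) 0 ⟩
        0ℤ ∎
      S = ∑ p f
      solve-S : ∀ S P E → S ℤ.+ P ℤ.* E ≡ 0ℤ → S ≡ P ℤ.* (-1ℤ ℤ.* E)
      solve-S S P E eq = trans (tidy S P E) (trans (cong (ℤ._+ P ℤ.* (-1ℤ ℤ.* E)) eq) (ℤ.+-identityˡ _))
        where
        tidy : ∀ S P E → S ≡ S ℤ.+ P ℤ.* E ℤ.+ P ℤ.* (-1ℤ ℤ.* E)
        tidy = solve-∀
      value : S ≡ + p ℤ.* (-1ℤ ℤ.* ⟦ E ⟧ f 0)
      value = solve-S S (+ p) (⟦ E ⟧ f 0) (begin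
        S ℤ.+ + p ℤ.* ⟦ E ⟧ f 0
          ≡⟨ cong (ℤ._+ + p ℤ.* ⟦ E ⟧ f 0) (trans (sum-act p (X ^_) f 0) (∑-cong p λ i _ →
               trans (X^-act i f 0) (cong f (ℕ.+-identityʳ i)))) ⟨
        ⟦ geometric X p ⟧ f 0 ℤ.+ + p ℤ.* ⟦ E ⟧ f 0
          ≡⟨ at eq f 0 ⟨
        ⟦ (1# - X) ^ p′ ⟧ f 0
          ≡⟨ killed ⟩
        0ℤ ∎)

    ∑-≡ₚ : ∀ n {f h} → (∀ i → i < n → f i ≡ₚ h i) → + p ∣ₚ ∑ n h → + p ∣ₚ ∑ n f
    ∑-≡ₚ zero    _     ph = ph
    ∑-≡ₚ n@(suc _) {f} {h} f≡h ph = subst (+ p ∣ₚ_)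
      (trans (sym (∑-+ n (λ i → f i ℤ.- h i) h)) (∑-cong n λ i _ → cancel (f i) (h i)))
      (∣ₚ-+ (∑-∣ n f≡h) ph)
      where
      cancel : ∀ a b → a ℤ.- b ℤ.+ b ≡ a
      cancel = solve-∀
      ∑-∣ : ∀ n {f} → (∀ i → i < n → + p ∣ₚ f i) → + p ∣ₚ ∑ n f
      ∑-∣ zero    pf = ∣⇒∣ₚ (divides 0ℤ refl)
      ∑-∣ (suc n) pf = ∣ₚ-+ (pf 0 (s≤s z≤n)) (∑-∣ n λ i i<n → pf (suc i) (s≤s i<n))

    -- Modulo p the sum becomes that of the (p-3)-th powers. Since the squares of C(p,i) add up to
    -- C(2p,p), this is C(2p,p) ≡ 2 modulo p³.
    wolstenholme : 1 ≤ m → + p ∣ₚ ∑ p′ (λ i → + c i ℤ.* + c i)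
    -- Once `m` is a successor, 0^m reduces to 0, so the term i = 0 of `∑-pow` drops out.
    wolstenholme (s≤s z≤n) = ∑-≡ₚ p′ (λ i i<p′ → c²≡ i<p′)
      (subst (+ p ∣ₚ_) (ℤ.+-identityˡ (∑ p′ (λ i → (+ suc i) ℤ.^ m))) ∑-pow)

  g-U : ∀ f → ⟦ g ⟧ (U p f) 0 ≡ 0ℤ
  g-U f = trans (g-act (U p f) 0) (∑-zero p′ λ i i<p′ →
    trans (cong (λ z → + c i ℤ.* U p f z) (ℕ.+-identityʳ (suc i)))
      (trans (cong (ℤ._*_ (+ c i)) (U-∤ p f (p∤< i<p′))) (ℤ.*-zeroʳ (+ c i))))

  -- The sum (i+1) + (j+1) lies strictly between 0 and 2p, so as a multiple of p it could only be p,
  -- which is the excluded `j`.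
  p∤i+j : ∀ {i j} → i < p′ → j < p′ → j ≢ p′ ℕ.∸ suc i → ¬ p ℕ.∣ suc j ℕ.+ (suc i)
  p∤i+j {i} {j} i<p′ j<p′ j≢ (ℕ.divides 0 ())
  p∤i+j {i} {j} i<p′ j<p′ j≢ (ℕ.divides 1 eq) = j≢ (sym (trans
    (cong (ℕ._∸ suc i) (sym (trans (ℕ.suc-injective eq) (ℕ.+-identityʳ p′)))) (ℕ.m+n∸n≡m j (suc i))))
  p∤i+j {i} {j} i<p′ j<p′ j≢ (ℕ.divides (suc (suc k)) eq) = ℕ.<⇒≢
    (ℕ.<-≤-trans (ℕ.+-mono-< (s≤s j<p′) (s≤s i<p′))
      (ℕ.≤-trans (ℕ.m≤m+n (p ℕ.+ p) (k ℕ.* p)) (ℕ.≤-reflexive (ℕ.+-assoc p p (k ℕ.* p))))) eq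

  -- The positions (i+1) + (j+1) read by g² meet the support of `U p f` only at p. There j + 1 = p -
  -- (i+1), and the symmetry of binomial coefficients makes the product a square.
  g²-U : ∀ f → ⟦ g ⟧ (⟦ g ⟧ (U p f)) 0 ≡ ∑ p′ (λ i → + c i ℤ.* + c i) ℤ.* U p f p
  g²-U f = trans (g-act (⟦ g ⟧ (U p f)) 0) (trans (∑-cong p′ inner) (∑-*ʳ p′ _ (U p f p)))
    where
    open ≡-Reasoning
    inner : ∀ i → i < p′ → + c i ℤ.* ⟦ g ⟧ (U p f) (suc i ℕ.+ 0) ≡ + c i ℤ.* + c i ℤ.* U p f p
    inner i i<p′ = begin
      + c i ℤ.* ⟦ g ⟧ (U p f) (suc i ℕ.+ 0)
        ≡⟨ cong (λ z → + c i ℤ.* ⟦ g ⟧ (U p f) z) (ℕ.+-identityʳ (suc i)) ⟩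
      + c i ℤ.* ⟦ g ⟧ (U p f) (suc i)
        ≡⟨ cong (ℤ._*_ (+ c i)) (g-act (U p f) (suc i)) ⟩
      + c i ℤ.* ∑ p′ h
        ≡⟨ cong (ℤ._*_ (+ c i)) (∑-single p′ j<p′ λ j j<p′ j≢ →
             trans (cong (ℤ._*_ (+ c j)) (U-∤ p f (p∤i+j i<p′ j<p′ j≢))) (ℤ.*-zeroʳ (+ c j))) ⟩
      + c i ℤ.* (+ c (p′ ℕ.∸ suc i) ℤ.* U p f (suc (p′ ℕ.∸ suc i) ℕ.+ suc i))
        ≡⟨ cong₂ (λ a b → + c i ℤ.* (+ a ℤ.* U p f b)) (c-symm i<p′) (cong suc (ℕ.m∸n+n≡m i<p′)) ⟩
      + c i ℤ.* (+ c i ℤ.* U p f p)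
        ≡⟨ ℤ.*-assoc (+ c i) (+ c i) _ ⟨
      + c i ℤ.* + c i ℤ.* U p f p ∎
      where
      h : ℕ → ℤ
      h j = + c j ℤ.* U p f (suc j ℕ.+ suc i)
      j<p′ : p′ ℕ.∸ suc i < p′
      j<p′ = ℕ.∸-monoʳ-< {p′} {suc i} {0} (s≤s z≤n) i<p′

-- Divisibility of the terms of the expansion

aₚ-bound : ∀ p′ → 1 ≤ p′ → ∀ {j} → 2 ≤ j → (p′ ≤ 2) ⊎ (3 ≤ j) →
           aₚ (suc p′) ≤ j × (∀ m → suc m ℕ.* suc p′ ≤ j → aₚ (suc p′) ℕ.+ (suc m ℕ.+ m) ≤ j)
aₚ-bound 1 _ 2≤j _ = ℕ.<⇒≤ 2≤j , λ m → ℕ.≤-trans (ℕ.≤-reflexive (arrange m))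
  where
  arrange : ∀ m → suc (suc m ℕ.+ m) ≡ suc m ℕ.* 2
  arrange = ℕSolver.solve-∀
aₚ-bound 2 _ 2≤j _ = 2≤j , λ m → ℕ.≤-trans (ℕ.≤-trans (ℕ.m≤m+n _ m) (ℕ.≤-reflexive (arrange m)))
  where
  arrange : ∀ m → suc (suc (suc m ℕ.+ m)) ℕ.+ m ≡ suc m ℕ.* 3
  arrange = ℕSolver.solve-∀
-- From here on p ≥ 4 and `aₚ` is 3, so j = 2 has to be ruled out by the hypothesis. For j ≥ 3 the
-- second bound is 2m + 4 ≤ (m+1) p.
aₚ-bound (suc (suc (suc _))) _ _ (inj₁ (s≤s (s≤s ())))
aₚ-bound (suc (suc (suc t))) _ _ (inj₂ 3≤j) = 3≤j , λ m →
  ℕ.≤-trans (ℕ.≤-trans (ℕ.m≤m+n _ (m ℕ.+ m ℕ.+ suc m ℕ.* t)) (ℕ.≤-reflexive (arrange m t)))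
  where
  arrange : ∀ m t → suc (suc (suc (suc m ℕ.+ m))) ℕ.+ (m ℕ.+ m ℕ.+ suc m ℕ.* t) ≡
            suc m ℕ.* suc (suc (suc (suc t)))
  arrange = ℕSolver.solve-∀

module Difference (p′ : ℕ) (pp : Prime (suc p′)) (q : ℕ) .{{_ : NonZero q}} (f : ℕ → ℤ) where

  private
    p = suc p′
    a = aₚ p

  open Local p pp
  open Frobenius p′ pp
  open Congruence p′ pp

  1≤p′ : 1 ≤ p′
  1≤p′ = ℕ.s≤s⁻¹ 1<p

  -- Multiplying the hypothesis by `[n/q]!∣` gives this with an extra j! on both sides, which
  -- cancels. The exponent `b` is the power of p available in the term.
  binomial-factor : ∀ {n j b} → j ≤ n → p ℕ.^ a ℕ.* j ! ∣ₙ p ℕ.^ b →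
    p ℕ.^ a ℕ.* (n ℕ./ q) ! ∣ₙ (n C j) ℕ.* (p ℕ.^ b ℕ.* ((n ℕ.∸ j) ℕ./ q) !)
  binomial-factor {n} {j} {b} j≤n d = ∣ₚ-cancelˡ (+ (j !)) {{j ℕ.!≢0}} (subst₂ _∣ₚ_
    (trans (cong +_ (arrange₁ (p ℕ.^ a) (j !) _)) (ℤ.pos-* (j !) _))
    (trans (cong +_ (arrange₂ (p ℕ.^ b) (j !) (n C j) _)) (ℤ.pos-* (j !) _))
    (∣ₙ-*-mono d (∣⇒∣ₙ ([n/q]!∣ q j≤n))))
    where
    arrange₁ : ∀ a b c → a ℕ.* b ℕ.* c ≡ b ℕ.* (a ℕ.* c)
    arrange₁ = ℕSolver.solve-∀
    arrange₂ : ∀ a b c d → a ℕ.* (b ℕ.* c ℕ.* d) ≡ b ℕ.* (c ℕ.* (a ℕ.* d))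
    arrange₂ = ℕSolver.solve-∀

  module _ (divides-f : ∀ m k → + ((m ℕ./ q) !) ∣ₚ ⟦ (1# - X) ^ m ⟧ f k) (n : ℕ) where

    private
      N! = (n ℕ./ q) !

      t : ℕ → Poly
      t j = (n C j) · ((nat p * g) ^ j * (X ^ p + 1#) ^ (n ℕ.∸ j))

      V : ℕ → ℤ
      V j = ⟦ g ^ j ⟧ (U p (⟦ (1# - X) ^ (n ℕ.∸ j) ⟧ f)) 0

      M : ℕ → ℕ
      M j = ((n ℕ.∸ j) ℕ./ q) !

    t-act : ∀ j → ⟦ t j ⟧ (U p f) 0 ≡ + (n C j) ℤ.* (+ (p ℕ.^ j) ℤ.* V j)
    t-act j = trans (·-act (n C j) _ (U p f) 0) (cong (ℤ._*_ (+ (n C j))) (trans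
      (at (≈-trans (*-^ (nat p) g j) (*-congʳ {g ^ j} (nat-^ p j))) _ 0)
      (cong (ℤ._*_ (+ (p ℕ.^ j))) (⟦⟧-cong (g ^ j) ([X^m+1]^-U p (n ℕ.∸ j) f) 0))))

    U-divides : ∀ {d h} → (∀ k → d ∣ₚ h k) → ∀ i → d ∣ₚ U p h i
    U-divides dh i with p ℕ.∣? i
    ... | yes (ℕ.divides k _) = ∣ₚ-*ˡ (-1ℤ ℤ.^ k) (dh k)
    ... | no  _               = ∣⇒∣ₚ (divides 0ℤ refl)

    M∣V : ∀ j → + M j ∣ₚ V j
    M∣V j = ∣ₚ-⟦⟧ (g ^ j) (U-divides (divides-f (n ℕ.∸ j))) 0

    -- `e` is the divisor of `V j` found beyond the factorial `M j`: 1 for a generic term, p where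
    -- Wolstenholme's congruence applies.
    term : ∀ {j b e} → j ≤ n → p ℕ.^ a ℕ.* j ! ∣ₙ p ℕ.^ b → p ℕ.^ b ≡ p ℕ.^ j ℕ.* e →
           + (e ℕ.* M j) ∣ₚ V j → + (p ℕ.^ a ℕ.* N!) ∣ₚ ⟦ t j ⟧ (U p f) 0
    term {j} {b} {e} j≤n d p^b≡ eM∣V = ∣ₚ-trans (binomial-factor {b = b} j≤n d)
      (subst₂ _∣ₚ_ (trans (cong (ℤ._*_ (+ (n C j))) (sym (ℤ.pos-* (p ℕ.^ j) (e ℕ.* M j))))
                     (trans (sym (ℤ.pos-* (n C j) _)) (cong (λ z → + ((n C j) ℕ.* z))
                       (trans (sym (ℕ.*-assoc (p ℕ.^ j) e (M j))) (cong (ℕ._* M j) (sym p^b≡))))))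
        (sym (t-act j)) (∣ₚ-*-mono (∣ₚ-refl {+ (n C j)}) (∣ₚ-*-mono (∣ₚ-refl {+ (p ℕ.^ j)}) eM∣V)))

    generic-term : ∀ {j} → j ≤ n → 2 ≤ j → (p′ ≤ 2) ⊎ (3 ≤ j) →
                   + (p ℕ.^ a ℕ.* N!) ∣ₚ ⟦ t j ⟧ (U p f) 0
    generic-term {j} j≤n 2≤j cases with aₚ-bound p′ 1≤p′ 2≤j cases
    ... | a≤j , bound = term {b = j} {e = 1} j≤n (p^a*j!∣p^j a≤j bound) (sym (ℕ.*-identityʳ _))
      (subst (λ z → + z ∣ₚ V j) (sym (ℕ.*-identityˡ (M j))) (M∣V j))

    -- Two factors p come from (p g)² and the third from `wolstenholme` through `g²-U`; the
    -- denominator 2! is a unit because p > 3.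
    quadratic-term : ∀ m → p′ ≡ suc (suc m) → 1 ≤ m → 2 ≤ n → + (p ℕ.^ a ℕ.* N!) ∣ₚ ⟦ t 2 ⟧ (U p f) 0
    quadratic-term m p′≡ 1≤m 2≤n = term {b = 3} {e = p} 2≤n p^a*2∣p^3 (ℕ.*-comm p (p ℕ.^ 2)) (subst₂ _∣ₚ_
        (sym (ℤ.pos-* p (M 2)))
        (sym (trans (⟦⟧-cong g (⟦⟧-cong g λ i → ℤ.*-identityˡ _) 0) (g²-U _)))
        (∣ₚ-*-mono (wolstenholme m p′≡ 1≤m) (U-divides (divides-f (n ℕ.∸ 2)) p)))
      where
      a≡3 : ∀ {p′} m → p′ ≡ suc (suc m) → 1 ≤ m → aₚ (suc p′) ≡ 3
      a≡3 (suc m) refl _ = refl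
      p∤2 : ¬ p ℕ.∣ 2
      p∤2 = ℕ.>⇒∤ (subst (λ z → 2 < suc z) (sym p′≡) (s≤s (s≤s (s≤s z≤n))))
      p^a*2∣p^3 : p ℕ.^ a ℕ.* 2 ∣ₙ p ℕ.^ 3
      p^a*2∣p^3 = subst₂ (λ x y → p ℕ.^ x ℕ.* 2 ∣ₙ y) (sym (a≡3 m p′≡ 1≤m)) (ℕ.*-identityʳ _)
        (∣ₙ-*-mono (∣ₚ-refl {+ (p ℕ.^ 3)}) (∣ₚ-unitˡ p∤2))

    each-term : ∀ j → suc j ≤ n → + (p ℕ.^ a ℕ.* N!) ∣ₚ ⟦ t (suc j) ⟧ (U p f) 0
    each-term 0 1≤n = subst (+ (p ℕ.^ a ℕ.* N!) ∣ₚ_)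
      (sym (trans (t-act 1) (trans (cong (λ z → + (n C 1) ℤ.* (+ (p ℕ.^ 1) ℤ.* z)) V1≡0)
        (trans (cong (ℤ._*_ (+ (n C 1))) (ℤ.*-zeroʳ (+ (p ℕ.^ 1)))) (ℤ.*-zeroʳ (+ (n C 1)))))))
      (∣⇒∣ₚ (divides 0ℤ refl))
      where
      V1≡0 : V 1 ≡ 0ℤ
      V1≡0 = trans (⟦⟧-cong g (λ i → ℤ.*-identityˡ _) 0) (g-U _)
    -- The argument is one less than the index of the term, so this is j = 2. For p ≤ 3 the two
    -- factors p of (p g)² suffice.
    each-term 1 2≤n with p′ ℕ.≤? 2
    ... | yes p′≤2 = generic-term 2≤n ℕ.≤-refl (inj₁ p′≤2)
    ... | no  p′≰2 = quadratic-term (p′ ℕ.∸ 2) (sym (ℕ.m+[n∸m]≡n (ℕ.<⇒≤ (ℕ.≰⇒> p′≰2))))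
                       (ℕ.m<n⇒0<n∸m (ℕ.≰⇒> p′≰2)) 2≤n
    each-term (suc (suc j)) j≤n = generic-term j≤n (s≤s (s≤s z≤n)) (inj₂ (s≤s (s≤s (s≤s z≤n))))

    difference : + (p ℕ.^ a ℕ.* N!) ∣ₚ
                 ⟦ (X + 1#) ^ (p ℕ.* n) ⟧ (U p f) 0 ℤ.- ⟦ (1# - X) ^ n ⟧ f 0
    difference = subst (+ (p ℕ.^ a ℕ.* N!) ∣ₚ_) (sym value)
      (sum-preserves (λ P → + (p ℕ.^ a ℕ.* N!) ∣ₚ ⟦ P ⟧ (U p f) 0) (∣⇒∣ₚ (divides 0ℤ refl)) ∣ₚ-+
        tail (λ i → each-term (toℕ i) (toℕ<n i)))
      where
      open ≡-Reasoning
      tail : Fin n → Poly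
      tail i = t (suc (toℕ i))
      cancel : ∀ {a b c} → b ≡ c → b ℤ.+ a ℤ.- c ≡ a
      cancel {a} {b} refl = tidy a b
        where
        tidy : ∀ a b → b ℤ.+ a ℤ.- b ≡ a
        tidy = solve-∀
      head : ⟦ t 0 ⟧ (U p f) 0 ≡ ⟦ (1# - X) ^ n ⟧ f 0
      head = begin
        ⟦ t 0 ⟧ (U p f) 0                   ≡⟨ t-act 0 ⟩
        1ℤ ℤ.* (1ℤ ℤ.* V 0)                 ≡⟨ trans (ℤ.*-identityˡ _) (ℤ.*-identityˡ _) ⟩
        V 0                                 ≡⟨ ℤ.*-identityˡ _ ⟩
        U p (⟦ (1# - X) ^ n ⟧ f) (0 ℕ.* p)  ≡⟨ U-multiple p (⟦ (1# - X) ^ n ⟧ f) 0 ⟩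
        1ℤ ℤ.* ⟦ (1# - X) ^ n ⟧ f 0         ≡⟨ ℤ.*-identityˡ _ ⟩
        ⟦ (1# - X) ^ n ⟧ f 0                ∎
      value : ⟦ (X + 1#) ^ (p ℕ.* n) ⟧ (U p f) 0 ℤ.- ⟦ (1# - X) ^ n ⟧ f 0 ≡ ⟦ sum tail ⟧ (U p f) 0
      value = trans (cong (ℤ._- ⟦ (1# - X) ^ n ⟧ f 0) (at (≈-trans
          (≈-sym (^-assocʳ (X + 1#) p n)) (≈-trans (^-congˡ n X+1^p)
            (Binomial.theorem commutativeSemiring n (nat p * g) (X ^ p + 1#)))) (U p f) 0))
        (cancel head)

-- Rational values of the two sums

-- Normalisation blocks computation in ℚ; unnormalised fractions compute, so the laws for `ℤ→ℚ` are
-- obtained through them.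
fromℚᵘ-* : ∀ x y → ℚ.fromℚᵘ (x ℚᵘ.* y) ≡ ℚ.fromℚᵘ x ℚ.* ℚ.fromℚᵘ y
fromℚᵘ-* x y = ℚ.toℚᵘ-injective (ℚᵘ.≃-trans (ℚ.toℚᵘ-fromℚᵘ (x ℚᵘ.* y)) (ℚᵘ.≃-sym
  (ℚᵘ.≃-trans (ℚ.toℚᵘ-homo-* (ℚ.fromℚᵘ x) (ℚ.fromℚᵘ y)) (ℚᵘ.*-cong (ℚ.toℚᵘ-fromℚᵘ x) (ℚ.toℚᵘ-fromℚᵘ y)))))

fromℚᵘ-+ : ∀ x y → ℚ.fromℚᵘ (x ℚᵘ.+ y) ≡ ℚ.fromℚᵘ x ℚ.+ ℚ.fromℚᵘ y
fromℚᵘ-+ x y = ℚ.toℚᵘ-injective (ℚᵘ.≃-trans (ℚ.toℚᵘ-fromℚᵘ (x ℚᵘ.+ y)) (ℚᵘ.≃-sym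
  (ℚᵘ.≃-trans (ℚ.toℚᵘ-homo-+ (ℚ.fromℚᵘ x) (ℚ.fromℚᵘ y)) (ℚᵘ.+-cong (ℚ.toℚᵘ-fromℚᵘ x) (ℚ.toℚᵘ-fromℚᵘ y)))))

ℤ→ℚ-* : ∀ a b → ℤ→ℚ (a ℤ.* b) ≡ ℤ→ℚ a ℚ.* ℤ→ℚ b
ℤ→ℚ-* a b = fromℚᵘ-* (mkℚᵘ a 0) (mkℚᵘ b 0)

ℤ→ℚ-+ : ∀ a b → ℤ→ℚ (a ℤ.+ b) ≡ ℤ→ℚ a ℚ.+ ℤ→ℚ b
ℤ→ℚ-+ a b = trans (cong ℤ→ℚ (cong₂ ℤ._+_ (sym (ℤ.*-identityʳ a)) (sym (ℤ.*-identityʳ b))))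
  (fromℚᵘ-+ (mkℚᵘ a 0) (mkℚᵘ b 0))

ℤ→ℚ-^ : ∀ a n → ℤ→ℚ a ^ℚ n ≡ ℤ→ℚ (a ℤ.^ n)
ℤ→ℚ-^ a zero    = refl
ℤ→ℚ-^ a (suc n) = trans (cong (ℤ→ℚ a ℚ.*_) (ℤ→ℚ-^ a n)) (sym (ℤ→ℚ-* a (a ℤ.^ n)))

[a*q]/q : ∀ a q .{{_ : NonZero q}} → (a ℤ.* + q) ℚ./ q ≡ ℤ→ℚ a
[a*q]/q a (suc d) = ℚ.fromℚᵘ-cong {mkℚᵘ (a ℤ.* + suc d) d} {mkℚᵘ a 0} (*≡* (ℤ.*-identityʳ _))

1/q*q : ∀ q .{{_ : NonZero q}} → (+ 1 ℚ./ q) ℚ.* ℕ→ℚ q ≡ 1ℚ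
1/q*q (suc d) = trans (sym (fromℚᵘ-* (mkℚᵘ (+ 1) d) (mkℚᵘ (+ suc d) 0)))
  (ℚ.fromℚᵘ-cong {mkℚᵘ (+ 1) d ℚᵘ.* mkℚᵘ (+ suc d) 0} {mkℚᵘ (+ 1) 0} (*≡* (cross (+ suc d))))
  where
  cross : ∀ q → 1ℤ ℤ.* q ℤ.* 1ℤ ≡ 1ℤ ℤ.* (q ℤ.* 1ℤ)
  cross = solve-∀

foldr-applyUpTo : ∀ n (F : ℕ → ℚ) (g : ℕ → ℕ) (h : ℕ → ℤ) → (∀ k → F (g k) ≡ ℤ→ℚ (h k)) →
                  foldr ℚ._+_ 0ℚ (map F (applyUpTo g n)) ≡ ℤ→ℚ (∑ n h)
foldr-applyUpTo zero    F g h eq = refl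
foldr-applyUpTo (suc n) F g h eq =
  trans (cong₂ ℚ._+_ (eq 0) (foldr-applyUpTo n F (g ∘ suc) (h ∘ suc) (eq ∘ suc))) (sym (ℤ→ℚ-+ (h 0) (∑ n (h ∘ suc))))

-- A top-level copy of the selector local to `sumCong`, so that it can be reasoned about by name.
select : ℕ → ℤ → (ℕ → ℚ) → ℕ → ℚ
select m r f k with m ℕ.∣? ℤ.∣ + k ℤ.- r ∣
... | yes _ = f k
... | no  _ = 0ℚ

-- The summation function inside sumCong is local to it. Splitting off the first term lets
-- unification recover it from the remaining sum.
summand : ∀ n m r f → ∃[ F ] sumCong n m r f ≡
          select m r f 0 ℚ.+ foldr ℚ._+_ 0ℚ (map F (applyUpTo suc n))
summand n m r f with m ℕ.∣? ℤ.∣ + 0 ℤ.- r ∣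
... | yes _ = _ , refl
... | no  _ = _ , refl

summand≡select : ∀ n m r f k → proj₁ (summand n m r f) k ≡ select m r f k
-- The function recovered by `summand` is defined under this test at 0, so it reduces only after the
-- same case split.
summand≡select n m r f k with m ℕ.∣? ℤ.∣ + 0 ℤ.- r ∣
... | yes _ with m ℕ.∣? ℤ.∣ + k ℤ.- r ∣
...   | yes _ = refl
...   | no  _ = refl
summand≡select n m r f k | no _ with m ℕ.∣? ℤ.∣ + k ℤ.- r ∣
...   | yes _ = refl
...   | no  _ = refl

indicator : ℕ → ℤ → ℕ → ℤ
indicator m r k with m ℕ.∣? ℤ.∣ + k ℤ.- r ∣
... | yes _ = 1ℤ
... | no  _ = 0ℤ

-- Integral values are required on the residue class only; elsewhere the quotient (k - r) / q need
-- not be an integer.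
select≡ : ∀ m r f (h : ℕ → ℤ) → (∀ k → m ℕ.∣ ℤ.∣ + k ℤ.- r ∣ → f k ≡ ℤ→ℚ (h k)) →
          ∀ k → select m r f k ≡ ℤ→ℚ (h k ℤ.* indicator m r k)
select≡ m r f h eq k with m ℕ.∣? ℤ.∣ + k ℤ.- r ∣
... | yes d = trans (eq k d) (cong ℤ→ℚ (sym (ℤ.*-identityʳ (h k))))
... | no  _ = cong ℤ→ℚ (sym (ℤ.*-zeroʳ (h k)))

sumCong≡∑ : ∀ n m r f (h : ℕ → ℤ) → (∀ k → m ℕ.∣ ℤ.∣ + k ℤ.- r ∣ → f k ≡ ℤ→ℚ (h k)) →
            sumCong n m r f ≡ ℤ→ℚ (∑ (suc n) (λ k → h k ℤ.* indicator m r k))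
sumCong≡∑ n m r f h eq = trans (proj₂ (summand n m r f)) (trans
  (cong₂ ℚ._+_ (select≡ m r f h eq 0) (foldr-applyUpTo n (proj₁ (summand n m r f)) suc
    (λ k → h (suc k) ℤ.* indicator m r (suc k))
    (λ k → trans (summand≡select n m r f (suc k)) (select≡ m r f h eq (suc k)))))
  (sym (ℤ→ℚ-+ (h 0 ℤ.* indicator m r 0) (∑ n (λ k → h (suc k) ℤ.* indicator m r (suc k))))))

-- Adding a multiple B q makes k - r a natural number, so that its floor quotient can be computed in
-- ℕ. For r = a ≥ 0 the choice B = a works because a ≤ a q.
offset : ∀ r q .{{_ : NonZero q}} → ∃[ A ] ∃[ B ] + A ≡ + (B ℕ.* q) ℤ.- r
offset (+ a)    q = a ℕ.* q ℕ.∸ a , a , (begin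
  + (a ℕ.* q ℕ.∸ a)                        ≡⟨ cancel (+ (a ℕ.* q ℕ.∸ a)) (+ a) ⟨
  + (a ℕ.* q ℕ.∸ a) ℤ.+ + a ℤ.- + a        ≡⟨ cong (ℤ._- + a) (ℤ.pos-+ (a ℕ.* q ℕ.∸ a) a) ⟨
  + (a ℕ.* q ℕ.∸ a ℕ.+ a) ℤ.- + a          ≡⟨ cong (λ z → + z ℤ.- + a) (ℕ.m∸n+n≡m (ℕ.m≤m*n a q)) ⟩
  + (a ℕ.* q) ℤ.- + a                      ∎)
  where
  open ≡-Reasoning
  cancel : ∀ x a → x ℤ.+ a ℤ.- a ≡ x
  cancel = solve-∀
offset -[1+ a ] q = suc a , 0 , refl

module Weight (p q : ℕ) .{{_ : NonZero q}} (r : ℤ) where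

  private
    s = p ℕ.* q
    A = proj₁ (offset r q)
    B = proj₁ (proj₂ (offset r q))

    k+A : ∀ k → + (k ℕ.+ A) ≡ + k ℤ.- r ℤ.+ + (B ℕ.* q)
    k+A k = trans (ℤ.pos-+ k A) (trans (cong (ℤ._+_ (+ k)) (proj₂ (proj₂ (offset r q))))
      (regroup′ (+ k) r (+ (B ℕ.* q))))
      where
      regroup′ : ∀ k r b → k ℤ.+ (b ℤ.- r) ≡ k ℤ.- r ℤ.+ b
      regroup′ = solve-∀

  -- y k = ⌊ (k - r) / q ⌋
  y : ℕ → ℤ
  y k = + ((k ℕ.+ A) ℕ./ q) ℤ.- + B

  -- The floor makes this hold at every `k`, on the residue class or off it, as the Leibniz rule
  -- demands.
  y-shift : ∀ k → y (s ℕ.+ k) ≡ y k ℤ.+ + p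
  y-shift k = trans (cong (λ z → + z ℤ.- + B) step)
    (trans (cong (ℤ._- + B) (ℤ.pos-+ p _)) (regroup′ (+ p) (+ ((k ℕ.+ A) ℕ./ q)) (+ B)))
    where
    step : (s ℕ.+ k ℕ.+ A) ℕ./ q ≡ p ℕ.+ (k ℕ.+ A) ℕ./ q
    step = trans (cong (ℕ._/ q) (ℕ.+-assoc s k A)) (trans
      (ℕ.+-distrib-/-∣ˡ (k ℕ.+ A) (ℕ.n∣m*n p)) (cong (ℕ._+ (k ℕ.+ A) ℕ./ q) (ℕ.m*n/n≡m p q)))
    regroup′ : ∀ p z b → p ℤ.+ z ℤ.- b ≡ z ℤ.- b ℤ.+ p
    regroup′ = solve-∀

  y-exact : ∀ k → s ℕ.∣ ℤ.∣ + k ℤ.- r ∣ → + k ℤ.- r ≡ y k ℤ.* + q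
  y-exact k s∣k-r = begin
    + k ℤ.- r                                       ≡⟨ cancel (+ k ℤ.- r) (+ (B ℕ.* q)) ⟩
    + k ℤ.- r ℤ.+ + (B ℕ.* q) ℤ.- + (B ℕ.* q)       ≡⟨ cong (ℤ._- + (B ℕ.* q)) (k+A k) ⟨
    + (k ℕ.+ A) ℤ.- + (B ℕ.* q)                     ≡⟨ cong (λ z → + z ℤ.- + (B ℕ.* q)) (ℕ.m/n*n≡m q∣k+A) ⟨
    + ((k ℕ.+ A) ℕ./ q ℕ.* q) ℤ.- + (B ℕ.* q)       ≡⟨ cong₂ ℤ._-_ (ℤ.pos-* ((k ℕ.+ A) ℕ./ q) q) (ℤ.pos-* B q) ⟩
    + ((k ℕ.+ A) ℕ./ q) ℤ.* + q ℤ.- + B ℤ.* + q     ≡⟨ factor (+ ((k ℕ.+ A) ℕ./ q)) (+ B) (+ q) ⟩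
    y k ℤ.* + q                                     ∎
    where
    open ≡-Reasoning
    q∣k+A : q ℕ.∣ k ℕ.+ A
    q∣k+A = ℤ∣.∣⇒∣ᵤ (subst (+ q ℤ∣.∣_) (sym (k+A k)) (ℤ∣.∣m∣n⇒∣m+n
      (ℤ∣.∣ᵤ⇒∣ {+ q} {+ k ℤ.- r} (ℕ.∣-trans (ℕ.n∣m*n p) s∣k-r)) (ℤ∣.∣ᵤ⇒∣ {+ q} {+ (B ℕ.* q)} (ℕ.n∣m*n B))))
    cancel : ∀ x b → x ≡ x ℤ.+ b ℤ.- b
    cancel = solve-∀
    factor : ∀ x b q → x ℤ.* q ℤ.- b ℤ.* q ≡ (x ℤ.- b) ℤ.* q
    factor = solve-∀

  e : ℕ → ℤ
  e = indicator s r

  e-shift : ∀ k → e (s ℕ.+ k) ≡ e k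
  e-shift k with s ℕ.∣? ℤ.∣ + (s ℕ.+ k) ℤ.- r ∣ | s ℕ.∣? ℤ.∣ + k ℤ.- r ∣
  ... | yes _ | yes _ = refl
  ... | no  _ | no  _ = refl
  ... | yes d | no ¬d = contradiction (ℤ∣.∣⇒∣ᵤ {+ s} {+ k ℤ.- r} (ℤ∣.∣m+n∣m⇒∣n
    (subst (+ s ℤ∣.∣_) (s+k-r (+ s) (+ k) r) (ℤ∣.∣ᵤ⇒∣ {+ s} {+ (s ℕ.+ k) ℤ.- r} d)) (ℤ∣.∣-refl {+ s}))) ¬d
    where
    s+k-r : ∀ s k r → s ℤ.+ k ℤ.- r ≡ s ℤ.+ (k ℤ.- r)
    s+k-r = solve-∀
  ... | no ¬d | yes d = contradiction (ℤ∣.∣⇒∣ᵤ (subst (+ s ℤ∣.∣_) (s+k-r (+ s) (+ k) r)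
    (ℤ∣.∣m∣n⇒∣m+n (ℤ∣.∣-refl {+ s}) (ℤ∣.∣ᵤ⇒∣ {+ s} {+ k ℤ.- r} d)))) ¬d
    where
    s+k-r : ∀ s k r → s ℤ.+ (k ℤ.- r) ≡ s ℤ.+ k ℤ.- r
    s+k-r = solve-∀

module Values (p′ : ℕ) (pp : Prime (suc p′)) (β : ℕ) (r : ℤ) where

  private
    p = suc p′
    q = p ℕ.^ β
    instance
      q≢0 : NonZero q
      q≢0 = powNZ pp (suc β)

  open Local p pp
  open Weight p q r public
  open Ideal p pp (p ℕ.* q) y e y-shift e-shift
  open Frobenius p′ pp

  -- Here w = (1 - X)^q. `[1-X]^[p^β]` gives w = 1 - X^q + p H, and `w^p` with Y = X^q supplies the
  -- required expansion, whose leading part 1 - X^(p q) is ∇.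
  n!∣𝒞[1-X]^qn : ∀ n → n ! ∣𝒞 ((1# - X) ^ q) ^ n
  n!∣𝒞[1-X]^qn = n!∣𝒞w^n (≈-trans (proj₂ (proj₂ step)) (+-congʳ (+-congˡ {1#} (*-congˡ {const -1ℤ}
    (≈-trans (^-assocʳ X q p) (≈-reflexive (cong (X ^_) (ℕ.*-comm q p))))))))
    where step = w^p (proj₂ ([1-X]^[p^β] β))

  -- This is y^l e, built by recursion to mirror the constructor `times`, so that membership in `𝒞`
  -- is immediate.
  weight : ℕ → ℕ → ℤ
  weight zero    = e
  weight (suc l) = λ k → y k ℤ.* weight l k

  weight≡ : ∀ l k → weight l k ≡ y k ℤ.^ l ℤ.* e k
  weight≡ zero    k = sym (ℤ.*-identityˡ (e k))
  weight≡ (suc l) k = trans (cong (ℤ._*_ (y k)) (weight≡ l k)) (sym (ℤ.*-assoc (y k) (y k ℤ.^ l) (e k)))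

  weight∈𝒞 : ∀ l → 𝒞 (weight l)
  weight∈𝒞 zero    = base
  weight∈𝒞 (suc l) = times (weight∈𝒞 l)

  -- Writing m as m % q plus q ⌊m/q⌋ isolates a power of (1 - X)^q; the remaining operator preserves
  -- divisibility.
  [m/q]!∣weight : ∀ l m k → + ((m ℕ./ q) !) ∣ₚ ⟦ (1# - X) ^ m ⟧ (weight l) k
  [m/q]!∣weight l m k = _∣𝒞_.on (∣𝒞-resp split (∣𝒞-*ˡ ((1# - X) ^ (m ℕ.% q)) (n!∣𝒞[1-X]^qn (m ℕ./ q))))
    (weight∈𝒞 l) k
    where
    open ≈-Reasoning
    split : (1# - X) ^ (m ℕ.% q) * ((1# - X) ^ q) ^ (m ℕ./ q) ≈ₚ (1# - X) ^ m
    split = begin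
      (1# - X) ^ (m ℕ.% q) * ((1# - X) ^ q) ^ (m ℕ./ q)
        ≈⟨ *-congˡ {(1# - X) ^ (m ℕ.% q)} (^-assocʳ (1# - X) q (m ℕ./ q)) ⟩
      (1# - X) ^ (m ℕ.% q) * (1# - X) ^ (q ℕ.* (m ℕ./ q))
        ≈⟨ ^-homo-* (1# - X) (m ℕ.% q) (q ℕ.* (m ℕ./ q)) ⟨
      (1# - X) ^ (m ℕ.% q ℕ.+ q ℕ.* (m ℕ./ q))
        ≡⟨ cong (λ z → (1# - X) ^ (m ℕ.% q ℕ.+ z)) (ℕ.*-comm q (m ℕ./ q)) ⟩
      (1# - X) ^ (m ℕ.% q ℕ.+ m ℕ./ q ℕ.* q)
        ≡⟨ cong ((1# - X) ^_) (ℕ.m≡m%n+[m/n]*n m q) ⟨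
      (1# - X) ^ m ∎

  summand-value : ∀ l c k → (p ℕ.* q) ℕ.∣ ℤ.∣ + k ℤ.- r ∣ →
    sign k ℚ.* ℕ→ℚ c ℚ.* (quot pp (suc β) k r ^ℚ l) ≡ ℤ→ℚ (-1ℤ ℤ.^ k ℤ.* + c ℤ.* y k ℤ.^ l)
  summand-value l c k d = begin
    sign k ℚ.* ℕ→ℚ c ℚ.* (quot pp (suc β) k r ^ℚ l)
      ≡⟨ cong₂ (λ a b → a ℚ.* ℕ→ℚ c ℚ.* (b ^ℚ l)) (ℤ→ℚ-^ -1ℤ k)
           (trans (cong (λ z → z ℚ./ q) (y-exact k d)) ([a*q]/q (y k) q)) ⟩
    ℤ→ℚ (-1ℤ ℤ.^ k) ℚ.* ℕ→ℚ c ℚ.* (ℤ→ℚ (y k) ^ℚ l)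
      ≡⟨ cong₂ ℚ._*_ (sym (ℤ→ℚ-* (-1ℤ ℤ.^ k) (+ c))) (ℤ→ℚ-^ (y k) l) ⟩
    ℤ→ℚ (-1ℤ ℤ.^ k ℤ.* + c) ℚ.* ℤ→ℚ (y k ℤ.^ l)
      ≡⟨ ℤ→ℚ-* (-1ℤ ℤ.^ k ℤ.* + c) (y k ℤ.^ l) ⟨
    ℤ→ℚ (-1ℤ ℤ.^ k ℤ.* + c ℤ.* y k ℤ.^ l) ∎
    where open ≡-Reasoning

  sumCong-value : ∀ l n (c : ℕ → ℕ) →
    sumCong n (p ℕ.^ suc β) r (λ k → sign k ℚ.* ℕ→ℚ (c k) ℚ.* (quot pp (suc β) k r ^ℚ l)) ≡
    ℤ→ℚ (∑ (suc n) (λ k → + c k ℤ.* (-1ℤ ℤ.^ k ℤ.* weight l k)))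
  sumCong-value l n c = trans
    (sumCong≡∑ n (p ℕ.* q) r _ (λ k → -1ℤ ℤ.^ k ℤ.* + c k ℤ.* y k ℤ.^ l) (λ k → summand-value l (c k) k))
    (cong ℤ→ℚ (∑-cong (suc n) λ k _ → trans (arrange (-1ℤ ℤ.^ k) (+ c k) (y k ℤ.^ l) (e k))
      (cong (λ z → + c k ℤ.* (-1ℤ ℤ.^ k ℤ.* z)) (sym (weight≡ l k)))))
    where
    arrange : ∀ s c y e → s ℤ.* c ℤ.* y ℤ.* e ≡ c ℤ.* (s ℤ.* (y ℤ.* e))
    arrange = solve-∀

  LHS-value : ∀ l n → LHS pp (suc β) l n r ≡
    invFact (n ℕ./ q) ℚ.* ℤ→ℚ (⟦ (X + 1#) ^ (p ℕ.* n) ⟧ (U p (weight l)) 0)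
  LHS-value l n = cong (invFact (n ℕ./ q) ℚ.*_) (trans
    (sumCong-value l n (λ k → (p ℕ.* n) C (p ℕ.* k))) (cong ℤ→ℚ (sym (U-expand p n (weight l)))))

  -- (1-X)^n is (1+X)^n conjugated by U 1.
  RHS-value : ∀ l n → RHS pp (suc β) l n r ≡
    invFact (n ℕ./ q) ℚ.* ℤ→ℚ (⟦ (1# - X) ^ n ⟧ (weight l) 0)
  RHS-value l n = cong (invFact (n ℕ./ q) ℚ.*_) (trans
    (sumCong-value l n (n C_)) (cong ℤ→ℚ (sym expand)))
    where
    open ≡-Reasoning
    f = weight l
    expand : ⟦ (1# - X) ^ n ⟧ f 0 ≡ ∑ (suc n) (λ k → + (n C k) ℤ.* (-1ℤ ℤ.^ k ℤ.* f k))
    expand = begin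
      ⟦ (1# - X) ^ n ⟧ f 0
        ≡⟨ ℤ.*-identityˡ _ ⟨
      1ℤ ℤ.* ⟦ (1# - X) ^ n ⟧ f 0
        ≡⟨ U-multiple 1 (⟦ (1# - X) ^ n ⟧ f) 0 ⟨
      U 1 (⟦ (1# - X) ^ n ⟧ f) 0
        ≡⟨ [X^m+1]^-U 1 n f 0 ⟨
      ⟦ (X ^ 1 + 1#) ^ n ⟧ (U 1 f) 0
        ≡⟨ at (^-congˡ n (solve 1 (λ x → x :* con 1ℤ :+ con 1ℤ := x :+ con 1ℤ) ≈-refl X)) (U 1 f) 0 ⟩
      ⟦ (X + 1#) ^ n ⟧ (U 1 f) 0
        ≡⟨ cong (λ z → ⟦ (X + 1#) ^ z ⟧ (U 1 f) 0) (ℕ.*-identityˡ n) ⟨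
      ⟦ (X + 1#) ^ (1 ℕ.* n) ⟧ (U 1 f) 0
        ≡⟨ U-expand 1 n f ⟩
      ∑ (suc n) (λ k → + ((1 ℕ.* n) C (1 ℕ.* k)) ℤ.* (-1ℤ ℤ.^ k ℤ.* f k))
        ≡⟨ ∑-cong (suc n) (λ k _ → cong₂ (λ a b → + (a C b) ℤ.* (-1ℤ ℤ.^ k ℤ.* f k))
             (ℕ.*-identityˡ n) (ℕ.*-identityˡ k)) ⟩
      ∑ (suc n) (λ k → + (n C k) ℤ.* (-1ℤ ℤ.^ k ℤ.* f k)) ∎

module _ {p : ℕ} (pp : Prime p) where

  open Local p pp

  -- The local unit and the cofactor of the divisibility serve as denominator `v` and numerator `u`;
  -- m! cancels against `invFact m`.
  ∣ₚ⇒CongPadic : ∀ b m a c {x y} → + (p ℕ.^ b ℕ.* m !) ∣ₚ a ℤ.- c →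
    x ≡ invFact m ℚ.* ℤ→ℚ a → y ≡ invFact m ℚ.* ℤ→ℚ c → CongPadic p b x y
  ∣ₚ⇒CongPadic b m a c (local v p∤v (divides u eq)) refl refl = u , v , p∤v , (begin
    (i ℚ.* ℤ→ℚ a ℚ.- i ℚ.* ℤ→ℚ c) ℚ.* ℕ→ℚ v
      ≡⟨ cong (λ z → (i ℚ.* z ℚ.- i ℚ.* ℤ→ℚ c) ℚ.* ℕ→ℚ v)
           (trans (cong ℤ→ℚ (split a c)) (ℤ→ℚ-+ (a ℤ.- c) c)) ⟩
    (i ℚ.* (ℤ→ℚ (a ℤ.- c) ℚ.+ ℤ→ℚ c) ℚ.- i ℚ.* ℤ→ℚ c) ℚ.* ℕ→ℚ v
      ≡⟨ cancel i (ℤ→ℚ (a ℤ.- c)) (ℤ→ℚ c) (ℕ→ℚ v) ⟩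
    i ℚ.* (ℕ→ℚ v ℚ.* ℤ→ℚ (a ℤ.- c))
      ≡⟨ cong (i ℚ.*_) (ℤ→ℚ-* (+ v) (a ℤ.- c)) ⟨
    i ℚ.* ℤ→ℚ (+ v ℤ.* (a ℤ.- c))
      ≡⟨ cong (λ z → i ℚ.* ℤ→ℚ z) (trans eq (trans (cong (ℤ._*_ u) (ℤ.pos-* (p ℕ.^ b) (m !)))
           (arrange u (+ (p ℕ.^ b)) (+ (m !))))) ⟩
    i ℚ.* ℤ→ℚ (+ (m !) ℤ.* (+ (p ℕ.^ b) ℤ.* u))
      ≡⟨ cong (i ℚ.*_) (ℤ→ℚ-* (+ (m !)) (+ (p ℕ.^ b) ℤ.* u)) ⟩
    i ℚ.* (ℕ→ℚ (m !) ℚ.* ℤ→ℚ (+ (p ℕ.^ b) ℤ.* u))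
      ≡⟨ ℚ.*-assoc i (ℕ→ℚ (m !)) (ℤ→ℚ (+ (p ℕ.^ b) ℤ.* u)) ⟨
    i ℚ.* ℕ→ℚ (m !) ℚ.* ℤ→ℚ (+ (p ℕ.^ b) ℤ.* u)
      ≡⟨ cong (ℚ._* ℤ→ℚ (+ (p ℕ.^ b) ℤ.* u)) (1/q*q (m !) {{m ℕ.!≢0}}) ⟩
    1ℚ ℚ.* ℤ→ℚ (+ (p ℕ.^ b) ℤ.* u)
      ≡⟨ ℚ.*-identityˡ _ ⟩
    ℤ→ℚ (+ (p ℕ.^ b) ℤ.* u) ∎)
    where
    open ≡-Reasoning
    i = invFact m
    split : ∀ a c → a ≡ a ℤ.- c ℤ.+ c
    split = solve-∀
    arrange : ∀ u p m → u ℤ.* (p ℤ.* m) ≡ m ℤ.* (p ℤ.* u)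
    arrange = solve-∀
    cancel : ∀ i d c v → (i ℚ.* (d ℚ.+ c) ℚ.- i ℚ.* c) ℚ.* v ≡ i ℚ.* (v ℚ.* d)
    cancel = ℚSolver.+-*-Solver.solve 4 (λ i d c v →
      (i ℚS.:* (d ℚS.:+ c) ℚS.:- i ℚS.:* c) ℚS.:* v ℚS.:= i ℚS.:* (v ℚS.:* d)) refl
      where module ℚS = ℚSolver.+-*-Solver

theorem1p3 : (p : ℕ) (pp : Prime p) (α : ℕ) → α ≥ 1 → (l n : ℕ) (r : ℤ) →
    CongPadic p (aₚ p) (LHS pp α l n r) (RHS pp α l n r)
theorem1p3 zero      pp _       _       l n r = contradiction pp ¬prime[0]
theorem1p3 p@(suc p′) pp (suc β) (s≤s z≤n) l n r =
  ∣ₚ⇒CongPadic pp (aₚ p) (n ℕ./ q)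
    (⟦ (X + 1#) ^ (p ℕ.* n) ⟧ (U p (weight l)) 0) (⟦ (1# - X) ^ n ⟧ (weight l) 0)
    (Difference.difference p′ pp q (weight l) ([m/q]!∣weight l) n)
    (LHS-value l n) (RHS-value l n)
  where
  open Values p′ pp β r
  q = p ℕ.^ β
  instance
    q≢0 : NonZero q
    q≢0 = powNZ pp (suc β)
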